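{- Let $\ell \ge -1$ be an integer, and let $P$ be an $(n+\ell)$-stable property for which $n(P)$ exists. Let $r\ge 3$ and $n \ge n(P)$ be integers, and suppose $n$ also satisfies $$n \ge \begin{cases} 6\ell+26 & \text{if } r=3\\ \max\left\{3+ \ell + \frac{4(\ell+2)}{r-3},\;5+\ell+\frac{r+2\ell+7}{2r-2}\right\} & \text{if } 4 \le r \le 7\\ \ell+5+\frac{4(\ell+4)}{r-4} & \text{if } r \ge 8.\end{cases}$$ Let $G$ be an $n$-vertex, $K_{r+1}$-free graph that does not have $P$. Then, for all $t \ge 2$, $$k^t(G) \leq k^t(G^{\ell*}_{n,r}).$$ If $G^{\ell*}_{n,r}$ does not have $P$ then the bound is tight.
   Context: Graphs are finite and simple; $d_G(v)$ is the degree of $v$ in $G$. A $t$-clique is a set of $t$ pairwise adjacent vertices; $k^t(G)$ denotes the number of $t$-cliques in $G$. For $s>0$, a property $P$ defined on all $n$-vertex graphs is $s$-stable if whenever $u,v$ are distinct nonadjacent vertices of an $n$-vertex graph $G$ such that $G+uv$ has $P$ and $d_G(u)+d_G(v)\ge s$, then $G$ itself has $P$. Here $(n+\ell)$-stable means $s=n+\ell$, where $n$ is the number of vertices. $n(P)$ denotes an integer such that each complete graph $K_n$ with $n\ge n(P)$ has property $P$, when such a value exists. $T_r(n)$ is the $n$-vertex, $r$-partite Turán graph: the complete $r$-partite graph on $n$ vertices with part sizes differing by at most 1 (if $n<r$ some parts are empty and it is $K_n$). For $-1 \le \ell \le \lceil (r-1)(n-1)/r\rceil-1$, $G^{\ell*}_{n,r}$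 denotes the graph formed from $T_r(n-1)$ by adding a new vertex $x$ such that the (subgraph induced by the) neighborhood of $x$ is isomorphic to $T_{r-1}(\ell+1)$ and disjoint from a smallest part of the $T_r(n-1)$. "Tight" means that equality is attained by some $n$-vertex, $K_{r+1}$-free graph not having $P$. -}

module Defs where

open import Level using (Level)
open import Data.Bool using (Bool; true; false; _∧_; _∨_; T; T?)
open import Data.Bool.Properties using (∧-comm; ∨-comm)
open import Data.Fin using (Fin; _≟_)
open import Data.Fin.Properties using (all?)
open import Data.Fin.Subset using (Subset; Side; inside; outside; _∈_; _∩_; ∣_∣; ∁; ⁅_⁆)
open import Data.Fin.Subset.Properties using (_∈?_)
open import Data.Integer as ℤ using (ℤ; +_; 1ℤ)
open import Data.List using (List; []; _∷_; _++_; map; filter; length)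
open import Data.Nat as ℕ using (ℕ; zero; suc; _≤_; _∸_; 2+)
open import Data.Product using (∃-syntax; _×_; _,_)
open import Data.Rational.Unnormalised as ℚᵘ using (ℚᵘ; _/_; 0ℚᵘ)
open import Data.Vec using ([]; _∷_; tabulate)
open import Function using (_⇔_)
open import Relation.Binary.PropositionalEquality
  using (_≡_; _≢_; refl; sym; trans; cong; cong₂)
open import Relation.Nullary using (¬_; Dec; yes; no; does; ¬?; contradiction; _×-dec_; _→-dec_)

private
  variable
    p : Level
    n : ℕ

record Graph (n : ℕ) : Set where
  field
    adj        : Fin n → Fin n → Bool
    adj-sym    : ∀ u v → adj u v ≡ adj v u
    adj-irrefl : ∀ v → adj v v ≡ false

open Graph public

Adj : Graph n → Fin n → Fin n → Set
Adj G u v = T (adj G u v)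

N : Graph n → Fin n → Subset n
N G v = tabulate (adj G v)

deg : Graph n → Fin n → ℕ
deg G v = ∣ N G v ∣

IsComplete : Graph n → Set
IsComplete G = ∀ u v → u ≢ v → Adj G u v

_==_ : Fin n → Fin n → Bool
u == v = does (u ≟ v)

private
  loopless : {u v : Fin n} → u ≢ v → ∀ a → (a == u) ∧ (a == v) ≡ false
  loopless {u = u} {v} u≢v a with a ≟ u | a ≟ v
  ... | yes a≡u | yes a≡v = contradiction (trans (sym a≡u) a≡v) u≢v
  ... | yes _   | no _    = refl
  ... | no _    | _       = refl

-- G + uv
addEdge : (G : Graph n) {u v : Fin n} → u ≢ v → Graph n
addEdge G {u} {v} u≢v = record
  { adj        = λ a b → adj G a b ∨ (((a == u) ∧ (b == v)) ∨ ((a == v) ∧ (b == u)))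
  ; adj-sym    = λ a b → cong₂ _∨_ (adj-sym G a b)
      (trans (∨-comm ((a == u) ∧ (b == v)) _)
             (cong₂ _∨_ (∧-comm (a == v) (b == u)) (∧-comm (a == u) (b == v))))
  ; adj-irrefl = λ a → cong₂ _∨_ (adj-irrefl G a)
      (cong₂ _∨_ (loopless u≢v a) (trans (∧-comm (a == v) (a == u)) (loopless u≢v a)))
  }

-- The requirement s > 0 is not imposed: the case of interest is s = n + ℓ with ℓ ≥ -1,
-- and if that is ≤ 0 then n ≤ 1, so there are no two distinct vertices.
Stable : ℤ → (Graph n → Set p) → Set p
Stable {n} s P = (G : Graph n) (u v : Fin n) (u≢v : u ≢ v) → ¬ Adj G u v →
  P (addEdge G u≢v) → s ℤ.≤ + (deg G u ℕ.+ deg G v) → P G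

IsClique : Graph n → Subset n → Set
IsClique G S = ∀ u → u ∈ S → ∀ v → v ∈ S → u ≢ v → Adj G u v

isClique? : (G : Graph n) (S : Subset n) → Dec (IsClique G S)
isClique? G S = all? λ u → (u ∈? S) →-dec all? λ v → (v ∈? S) →-dec
  (¬? (u ≟ v) →-dec T? (adj G u v))

-- Every subset of Fin n, listed exactly once.
subsets : ∀ n → List (Subset n)
subsets zero    = [] ∷ []
subsets (suc n) = map (outside ∷_) (subsets n) ++ map (inside ∷_) (subsets n)

-- k t G is the number k^t(G) of t-cliques of G.
k : ℕ → Graph n → ℕ
k {n} t G = length (filter (λ S → (∣ S ∣ ℕ.≟ t) ×-dec isClique? G S) (subsets n))

-- KFree s G: G is K_s-free.
KFree : ℕ → Graph n → Set
KFree s G = ¬ (∃[ S ] ∣ S ∣ ≡ s × IsClique G S)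

part : ∀ {r} → (Fin n → Fin r) → Fin r → Subset n
part c i = tabulate (λ v → c v == i)

-- The subgraph of G induced by S is the r-partite Turán graph on ∣ S ∣ vertices, the
-- parts being the sets S ∩ part c i (some possibly empty). Values of c outside S are
-- irrelevant.
record IsTuránOn (G : Graph n) (S : Subset n) {r : ℕ} (c : Fin n → Fin r) : Set where
  field
    multipartite : ∀ u v → u ∈ S → v ∈ S → Adj G u v ⇔ (c u ≢ c v)
    balanced     : ∀ i j → ∣ S ∩ part c i ∣ ≤ suc ∣ S ∩ part c j ∣

-- G is a copy of G^{ℓ*}_{n,r}. The definition does not determine which parts of T_r(n-1)
-- contain the larger parts of T_{r-1}(ℓ+1), so G^{ℓ*}_{n,r} is unique only up to that choice;
-- the number of t-cliques does not depend on it. For n ≥ 1 and r ≥ 2 a copy exists exactly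
-- when -1 ≤ ℓ ≤ ⌈(r-1)(n-1)/r⌉ - 1; the upper bound is forced by N-size and N-avoids.
record IsGStar (ℓ : ℤ) (r : ℕ) (G : Graph n) : Set where
  field
    x        : Fin n
    c        : Fin n → Fin r
    turán    : IsTuránOn G (∁ ⁅ x ⁆) c
    i₀       : Fin r
    smallest : ∀ i → ∣ ∁ ⁅ x ⁆ ∩ part c i₀ ∣ ≤ ∣ ∁ ⁅ x ⁆ ∩ part c i ∣
    N-avoids : ∀ v → v ∈ N G x → c v ≢ i₀
    N-size   : + ∣ N G x ∣ ≡ ℓ ℤ.+ 1ℤ
    c′       : Fin n → Fin (r ∸ 1)
    N-turán  : IsTuránOn G (N G x) c′

-- The lower bound required of n, for r ≥ 3; its value for r < 3 is never used.
-- Clauses are tried in order, so the last but one is the case 4 ≤ r ≤ 7.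
threshold : ℕ → ℤ → ℚᵘ
threshold 3 ℓ = (+ 6 ℤ.* ℓ ℤ.+ + 26) / 1
threshold r@(2+ (2+ (2+ (2+ _)))) ℓ =
  (ℓ ℤ.+ + 5) / 1 ℚᵘ.+ (+ 4 ℤ.* (ℓ ℤ.+ + 4)) / (r ∸ 4)
threshold r@(2+ (2+ _)) ℓ =
  ((+ 3 ℤ.+ ℓ) / 1 ℚᵘ.+ (+ 4 ℤ.* (ℓ ℤ.+ + 2)) / (r ∸ 3))
    ℚᵘ.⊔
  ((+ 5 ℤ.+ ℓ) / 1 ℚᵘ.+ (+ r ℤ.+ + 2 ℤ.* ℓ ℤ.+ + 7) / (2 ℕ.* r ∸ 2))
threshold _ _ = 0ℚᵘ

-- Adding edges between nonadjacent vertices of degree sum at least n + ℓ keeps G without P, and this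
-- closure is not complete. As in Chvátal's theorem, G then has a set of s ≥ 1 vertices of degree at most d,
-- where d < ℓ + 1 + s and 2d ≤ n + ℓ - 1. Deleting j ≤ s of them one at a time and applying Zykov's theorem
-- to the neighbourhoods and to what is left gives
--   k^t(G) ≤ k^t(T_r(n-j)) + j k^(t-1)(T_(r-1)(d)).
-- Since d ↦ k^(t-1)(T_(r-1)(d)) is convex and nondecreasing, this is at most
-- k^t(T_r(n-1)) + k^(t-1)(T_(r-1)(ℓ+1)) = k^t(G^{ℓ*}_{n,r}) as soon as it is so for t = 2, that is, as soon as
--   j d ≤ ℓ + 1 + Σ_{i=n-j}^{n-2} (i - ⌊i/r⌋).
-- One takes j = 1 if d ≤ ℓ + 1, and otherwise all s = d - ℓ vertices if r ≥ 8, and about half of them if r ≤ 7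
-- and n is large: for r = 3 the choice j = s fails when d is close to n/2.
module Submission where

open import Defs
open import Level using (Level; 0ℓ)
open import Data.Bool using (Bool; true; false; T; T?; _∧_; _∨_; not)
open import Data.Bool.Properties using (T-≡; T-∧; T-∨)
open import Data.Fin using (Fin; zero; suc; _≟_)
open import Data.Fin.Properties using (any?; nonZeroIndex)
open import Data.Fin.Subset
  using (Subset; inside; outside; _∈_; _∉_; _⊆_; _∩_; _-_; ∣_∣; ∁; ⁅_⁆; ⊤; ⊥; Nonempty)
open import Data.Fin.Subset.Properties
open import Data.List using (List; []; _∷_; _++_; map; filter; length; allFin)
open import Data.List.Extrema.Nat using (argmax; argmax-all; f[xs]≤f[argmax])
open import Data.List.Membership.Propositional.Properties using (∈-filter⁺; ∈-allFin)
open import Data.List.Properties using (filter-++; filter-≐; length-++; length-map; filter-none)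
import Data.List.Relation.Unary.All as All
open import Data.List.Relation.Unary.All.Properties using (all-filter)
open import Data.Nat as ℕ
  using (ℕ; zero; suc; _+_; _*_; _∸_; _≤_; _<_; _≤?_; _≤ᵇ_; z≤n; s≤s; s≤s⁻¹; ⌊_/2⌋)
open import Data.Nat.Divisibility using (∣-refl)
open import Data.Nat.DivMod using (m/n*n≤m; /-monoˡ-≤; +-distrib-/-∣ʳ; n/n≡1; m*n/n≡m)
open import Data.Nat.Induction using (Acc; acc; <-wellFounded)
open import Data.Nat.Properties hiding (_≟_; _≤?_)
open import Data.Nat.Tactic.RingSolver using (solve-∀)
open import Data.Product using (_×_; _,_; proj₁; proj₂; ∃-syntax; Σ-syntax)
open import Data.Sum using (_⊎_; inj₁; inj₂)
open import Data.Vec using ([]; _∷_; here; there; head; tail; sum; tabulate; _[_]≔_)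
open import Data.Vec.Properties
  using (lookup∘tabulate; []=⇒lookup; lookup⇒[]=; []≔-updates; []≔-minimal; lookup∘update′)
open import Function using (_⇔_; _∘_; mk⇔; Equivalence)
open import Relation.Binary.PropositionalEquality
  using (_≡_; _≢_; refl; sym; trans; cong; cong₂; subst; subst₂; module ≡-Reasoning)
open import Relation.Nullary using (¬_; Dec; yes; no; contradiction; ¬?; _×-dec_)
open import Relation.Nullary.Decidable using (decidable-stable)
open import Relation.Unary using (Pred; Decidable)

open Equivalence using (to; from)

private
  variable
    b : Level
    m n r : ℕ
    G : Graph n

-- Subsets and counting

∈-tabulate : {f : Fin n → Bool} {v : Fin n} → v ∈ tabulate f ⇔ T (f v)
∈-tabulate {f = f} {v} = mk⇔
  (λ v∈ → from T-≡ (trans (sym (lookup∘tabulate f v)) ([]=⇒lookup v∈)))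
  (λ fv → lookup⇒[]= v (tabulate f) (trans (lookup∘tabulate f v) (to T-≡ fv)))

∈-part : (c : Fin n → Fin r) {i : Fin r} {v : Fin n} → v ∈ part c i ⇔ c v ≡ i
∈-part c {i} {v} = mk⇔ (λ v∈ → ⇒ (to ∈-tabulate v∈)) (λ eq → from ∈-tabulate (⇐ eq))
  where
  ⇒ : T (c v == i) → c v ≡ i
  ⇒ with c v ≟ i
  ... | yes eq = λ _ → eq
  ⇐ : c v ≡ i → T (c v == i)
  ⇐ with c v ≟ i
  ... | yes _ = _
  ... | no ne = λ eq → contradiction eq ne

Adj-sym : (G : Graph n) {u v : Fin n} → Adj G u v → Adj G v u
Adj-sym G {u} {v} = subst T (adj-sym G u v)

Adj-irrefl : (G : Graph n) {v : Fin n} → ¬ Adj G v v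
Adj-irrefl G {v} = subst T (adj-irrefl G v)

∣p∩q∣+∣p∩∁q∣≡∣p∣ : (p q : Subset n) → ∣ p ∩ q ∣ + ∣ p ∩ ∁ q ∣ ≡ ∣ p ∣
∣p∩q∣+∣p∩∁q∣≡∣p∣ [] [] = refl
∣p∩q∣+∣p∩∁q∣≡∣p∣ (false ∷ p) (_ ∷ q) = ∣p∩q∣+∣p∩∁q∣≡∣p∣ p q
∣p∩q∣+∣p∩∁q∣≡∣p∣ (true ∷ p) (true ∷ q) = cong suc (∣p∩q∣+∣p∩∁q∣≡∣p∣ p q)
∣p∩q∣+∣p∩∁q∣≡∣p∣ (true ∷ p) (false ∷ q) =
  trans (+-suc ∣ p ∩ q ∣ ∣ p ∩ ∁ q ∣) (cong suc (∣p∩q∣+∣p∩∁q∣≡∣p∣ p q))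

x∈p⇒1+∣p-x∣≡∣p∣ : {p : Subset n} {x : Fin n} → x ∈ p → suc ∣ p - x ∣ ≡ ∣ p ∣
x∈p⇒1+∣p-x∣≡∣p∣ {p = true ∷ p} {zero} here = cong (suc ∘ ∣_∣) (p─⊥≡p p)
x∈p⇒1+∣p-x∣≡∣p∣ {p = true ∷ p} {suc x} (there x∈p) = cong suc (x∈p⇒1+∣p-x∣≡∣p∣ x∈p)
x∈p⇒1+∣p-x∣≡∣p∣ {p = false ∷ p} {suc x} (there x∈p) = x∈p⇒1+∣p-x∣≡∣p∣ x∈p

x∉p-x : (p : Subset n) (x : Fin n) → x ∉ p - x
x∉p-x (_ ∷ p) zero ()
x∉p-x (_ ∷ p) (suc x) (there x∈) = x∉p-x p x x∈

x∈p-y⁻ : (p : Subset n) {x : Fin n} (y : Fin n) → x ∈ p - y → x ∈ p × x ≢ y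
x∈p-y⁻ p y x∈ = p─q⊆p p ⁅ y ⁆ x∈ , λ { refl → x∉p-x p y x∈ }

0<∣p∣⇒Nonempty : (p : Subset n) → 0 < ∣ p ∣ → Nonempty p
0<∣p∣⇒Nonempty (true ∷ p) _ = zero , here
0<∣p∣⇒Nonempty (false ∷ p) 0<∣p∣ with x , x∈p ← 0<∣p∣⇒Nonempty p 0<∣p∣ = suc x , there x∈p

x∈p⇒0<∣p∣ : {p : Subset n} {x : Fin n} → x ∈ p → 0 < ∣ p ∣
x∈p⇒0<∣p∣ x∈p = subst (0 <_) (x∈p⇒1+∣p-x∣≡∣p∣ x∈p) (s≤s z≤n)

∣p∣≡0⇒Empty : (p : Subset n) → ∣ p ∣ ≡ 0 → {x : Fin n} → x ∉ p
∣p∣≡0⇒Empty p ∣p∣≡0 x∈p = <⇒≢ (x∈p⇒0<∣p∣ x∈p) (sym ∣p∣≡0)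

_⊕_ : Subset n → Fin n → Subset n
p ⊕ x = p [ x ]≔ inside

x∈p⊕x : (p : Subset n) (x : Fin n) → x ∈ p ⊕ x
x∈p⊕x = []≔-updates

p⊆p⊕x : {p : Subset n} (x : Fin n) → p ⊆ p ⊕ x
p⊆p⊕x {p = p} x {y} y∈p with y ≟ x
... | yes refl = x∈p⊕x p x
... | no y≢x = []≔-minimal p y x y≢x y∈p

x∈p⊕y⁻ : (p : Subset n) {x : Fin n} (y : Fin n) → x ∈ p ⊕ y → x ≡ y ⊎ x ∈ p
x∈p⊕y⁻ p {x} y x∈ with x ≟ y
... | yes x≡y = inj₁ x≡y
... | no x≢y = inj₂ (lookup⇒[]= x p (trans (sym (lookup∘update′ x≢y p inside)) ([]=⇒lookup x∈)))

∣p⊕x∣≡1+∣p∣ : (p : Subset n) (x : Fin n) → x ∉ p → ∣ p ⊕ x ∣ ≡ suc ∣ p ∣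
∣p⊕x∣≡1+∣p∣ (true ∷ p) zero x∉ = contradiction here x∉
∣p⊕x∣≡1+∣p∣ (false ∷ p) zero x∉ = refl
∣p⊕x∣≡1+∣p∣ (true ∷ p) (suc x) x∉ = cong suc (∣p⊕x∣≡1+∣p∣ p x (x∉ ∘ there))
∣p⊕x∣≡1+∣p∣ (false ∷ p) (suc x) x∉ = ∣p⊕x∣≡1+∣p∣ p x (x∉ ∘ there)

count : {P : Pred (Subset n) 0ℓ} → Decidable P → ℕ
count P? = length (filter P? (subsets _))

filter-map : ∀ {A B : Set} {P : Pred B 0ℓ} (P? : Decidable P) (f : A → B) (xs : List A) →
  filter P? (map f xs) ≡ map f (filter (P? ∘ f) xs)
filter-map P? f [] = refl
filter-map P? f (x ∷ xs) with P? (f x)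
... | yes _ = cong (f x ∷_) (filter-map P? f xs)
... | no _ = filter-map P? f xs

count-∷ : {P : Pred (Subset (suc n)) 0ℓ} (P? : Decidable P) →
  count P? ≡ count (P? ∘ (outside ∷_)) + count (P? ∘ (inside ∷_))
count-∷ {n = n} P? = begin
  length (filter P? (outs ++ ins))                                ≡⟨ cong length (filter-++ P? outs ins) ⟩
  length (filter P? outs ++ filter P? ins)                        ≡⟨ length-++ (filter P? outs) ⟩
  length (filter P? outs) + length (filter P? ins)                ≡⟨ cong₂ _+_ (half outside) (half inside) ⟩
  count (P? ∘ (outside ∷_)) + count (P? ∘ (inside ∷_))            ∎
  where
  open ≡-Reasoning
  outs = map (outside ∷_) (subsets n)
  ins = map (inside ∷_) (subsets n)
  half : ∀ s → length (filter P? (map (s ∷_) (subsets n))) ≡ count (P? ∘ (s ∷_))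
  half s = trans (cong length (filter-map P? (s ∷_) (subsets n))) (length-map (s ∷_) (filter (P? ∘ (s ∷_)) (subsets n)))

count-cong : {P Q : Pred (Subset n) 0ℓ} (P? : Decidable P) (Q? : Decidable Q) →
  (∀ {S} → P S ⇔ Q S) → count P? ≡ count Q?
count-cong P? Q? P⇔Q = cong length (filter-≐ P? Q? ((λ {S} → to (P⇔Q {S})) , (λ {S} → from (P⇔Q {S}))) (subsets _))

count-none : {P : Pred (Subset n) 0ℓ} (P? : Decidable P) → (∀ {S} → ¬ P S) → count P? ≡ 0
count-none P? ¬P = cong length (filter-none P? (All.universal (λ _ → ¬P) (subsets _)))

count-⊥ : {P : Pred (Subset n) 0ℓ} (P? : Decidable P) → (∀ {S} → P S ⇔ S ≡ ⊥) → count P? ≡ 1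
count-⊥ {n = zero} P? P⇔⊥ with P? []
... | yes _ = refl
... | no ¬P = contradiction (from P⇔⊥ refl) ¬P
count-⊥ {n = suc n} P? P⇔⊥ = trans (count-∷ P?) (cong₂ _+_
  (count-⊥ (P? ∘ (outside ∷_)) (mk⇔ (λ PS → cong tail (to P⇔⊥ PS)) (λ { refl → from P⇔⊥ refl })))
  (count-none (P? ∘ (inside ∷_)) (λ PS → contradiction (cong head (to P⇔⊥ PS)) λ ())))

-- The members of `P` without `v` are those of `Q`, and removing `v` from the others gives those of
-- `R`. As `Q` and `R` hold only for sets avoiding `v`, both correspondences are bijections.
count-delete : {P Q R : Pred (Subset n) 0ℓ} (P? : Decidable P) (Q? : Decidable Q) (R? : Decidable R) (v : Fin n) →
  (∀ {S} → Q S → v ∉ S) → (∀ {S} → R S → v ∉ S) →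
  (∀ {S} → v ∉ S → P S ⇔ Q S) → (∀ {S} → v ∉ S → P (S ⊕ v) ⇔ R S) →
  count P? ≡ count Q? + count R?
count-delete P? Q? R? zero Q⇒∉ R⇒∉ P⇔Q P⇔R = begin
  count P?                                               ≡⟨ count-∷ P? ⟩
  count (P? ∘ (outside ∷_)) + count (P? ∘ (inside ∷_))   ≡⟨ cong₂ _+_ eqQ eqR ⟩
  count Q? + count R?                                    ∎
  where
  open ≡-Reasoning
  eqQ : count (P? ∘ (outside ∷_)) ≡ count Q?
  eqQ = sym (trans (count-∷ Q?) (trans (cong₂ _+_
    (count-cong (Q? ∘ (outside ∷_)) (P? ∘ (outside ∷_)) (mk⇔ (from (P⇔Q λ ())) (to (P⇔Q λ ()))))
    (count-none (Q? ∘ (inside ∷_)) (λ QS → Q⇒∉ QS here))) (+-identityʳ _)))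
  eqR : count (P? ∘ (inside ∷_)) ≡ count R?
  eqR = sym (trans (count-∷ R?) (trans (cong₂ _+_
    (count-cong (R? ∘ (outside ∷_)) (P? ∘ (inside ∷_)) (mk⇔ (from (P⇔R λ ())) (to (P⇔R λ ()))))
    (count-none (R? ∘ (inside ∷_)) (λ RS → R⇒∉ RS here))) (+-identityʳ _)))
count-delete {n = suc n} {P} {Q} {R} P? Q? R? (suc v) Q⇒∉ R⇒∉ P⇔Q P⇔R = begin
  count P?                            ≡⟨ count-∷ P? ⟩
  count (P? ∘ (outside ∷_)) + count (P? ∘ (inside ∷_))
    ≡⟨ cong₂ _+_ (ih outside) (ih inside) ⟩
  (count (Q? ∘ (outside ∷_)) + count (R? ∘ (outside ∷_))) + (count (Q? ∘ (inside ∷_)) + count (R? ∘ (inside ∷_)))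
    ≡⟨ +-interchange (count (Q? ∘ (outside ∷_))) _ _ _ ⟩
  (count (Q? ∘ (outside ∷_)) + count (Q? ∘ (inside ∷_))) + (count (R? ∘ (outside ∷_)) + count (R? ∘ (inside ∷_)))
    ≡⟨ cong₂ _+_ (count-∷ Q?) (count-∷ R?) ⟨
  count Q? + count R?                 ∎
  where
  open ≡-Reasoning
  +-interchange : ∀ a b c d → (a + b) + (c + d) ≡ (a + c) + (b + d)
  +-interchange = solve-∀
  ∉-∷ : ∀ {s} {S : Subset n} → v ∉ S → suc v ∉ s ∷ S
  ∉-∷ v∉S (there v∈S) = v∉S v∈S
  ih : ∀ s → count (P? ∘ (s ∷_)) ≡ count (Q? ∘ (s ∷_)) + count (R? ∘ (s ∷_))
  ih s = count-delete (P? ∘ (s ∷_)) (Q? ∘ (s ∷_)) (R? ∘ (s ∷_)) v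
    (λ QS v∈S → Q⇒∉ QS (there v∈S)) (λ RS v∈S → R⇒∉ RS (there v∈S))
    (λ v∉S → P⇔Q (∉-∷ v∉S)) (λ v∉S → P⇔R (∉-∷ v∉S))

-- Cliques, Zykov's theorem and Turán graphs

∈N : {u v : Fin n} → u ∈ N G v ⇔ Adj G v u
∈N = ∈-tabulate

v∉Nv : (G : Graph n) (v : Fin n) → v ∉ N G v
v∉Nv G v v∈N = Adj-irrefl G {v} (to (∈N {G = G}) v∈N)

IsClique-⊆ : {Q S : Subset n} → Q ⊆ S → IsClique G S → IsClique G Q
IsClique-⊆ Q⊆S clique u u∈Q v v∈Q = clique u (Q⊆S u∈Q) v (Q⊆S v∈Q)

IsClique-⊕ : (G : Graph n) {Q : Subset n} (v : Fin n) → Q ⊆ N G v → IsClique G Q → IsClique G (Q ⊕ v)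
IsClique-⊕ G {Q} v Q⊆Nv clique x x∈ y y∈ x≢y with x∈p⊕y⁻ Q v x∈ | x∈p⊕y⁻ Q v y∈
... | inj₁ refl | inj₁ refl = contradiction refl x≢y
... | inj₁ refl | inj₂ y∈Q = to (∈N {G = G}) (Q⊆Nv y∈Q)
... | inj₂ x∈Q | inj₁ refl = Adj-sym G (to (∈N {G = G}) (Q⊆Nv x∈Q))
... | inj₂ x∈Q | inj₂ y∈Q = clique x x∈Q y y∈Q x≢y

-- Cliques are counted inside a vertex set `S` instead of in an induced subgraph, so that deletions
-- and neighbourhoods stay within the one graph `G`.
IsCliqueIn : Graph n → ℕ → Subset n → Subset n → Set
IsCliqueIn G t S Q = ∣ Q ∣ ≡ t × Q ⊆ S × IsClique G Q

isCliqueIn? : (G : Graph n) (t : ℕ) (S : Subset n) → Decidable (IsCliqueIn G t S)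
isCliqueIn? G t S Q = (∣ Q ∣ ℕ.≟ t) ×-dec (Q ⊆? S) ×-dec isClique? G Q

cliques : Graph n → ℕ → Subset n → ℕ
cliques G t S = count (isCliqueIn? G t S)

k≡cliques-⊤ : (t : ℕ) (G : Graph n) → k t G ≡ cliques G t ⊤
k≡cliques-⊤ t G = count-cong _ (isCliqueIn? G t ⊤)
  (mk⇔ (λ (size , clique) → size , ⊆⊤ , clique) (λ (size , _ , clique) → size , clique))

⊥-clique : (G : Graph n) (S : Subset n) → IsCliqueIn G 0 S ⊥
⊥-clique {n} G S = ∣⊥∣≡0 n , (λ x∈⊥ → contradiction x∈⊥ ∉⊥) , λ _ x∈⊥ → contradiction x∈⊥ ∉⊥

cliques-zero : (G : Graph n) (S : Subset n) → cliques G 0 S ≡ 1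
cliques-zero G S = count-⊥ (isCliqueIn? G 0 S) (mk⇔
  (λ (size , _) → Empty-unique λ (_ , x∈Q) → ∣p∣≡0⇒Empty _ size x∈Q)
  (λ { refl → ⊥-clique G S }))

cliques-empty : (G : Graph n) (t : ℕ) {S : Subset n} → ∣ S ∣ ≡ 0 → cliques G (suc t) S ≡ 0
cliques-empty G t {S} ∣S∣≡0 = count-none (isCliqueIn? G (suc t) S) λ {Q} (size , Q⊆S , _) →
  let v , v∈Q = 0<∣p∣⇒Nonempty Q (subst (0 <_) (sym size) (s≤s z≤n)) in ∣p∣≡0⇒Empty S ∣S∣≡0 (Q⊆S v∈Q)

-- A clique in `S` either avoids `v` or is `v` together with a clique in its neighbourhood. The
-- upper and the lower bounds on clique numbers all rest on this recursion.
cliques-delete : (G : Graph n) (t : ℕ) {S : Subset n} {v : Fin n} → v ∈ S →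
  cliques G (suc t) S ≡ cliques G (suc t) (S - v) + cliques G t (S ∩ N G v)
cliques-delete G t {S} {v} v∈S = count-delete
  (isCliqueIn? G (suc t) S) (isCliqueIn? G (suc t) (S - v)) (isCliqueIn? G t (S ∩ N G v)) v
  (λ (_ , Q⊆ , _) v∈Q → x∉p-x S v (Q⊆ v∈Q))
  (λ (_ , Q⊆ , _) v∈Q → v∉Nv G v (p∩q⊆q S _ (Q⊆ v∈Q)))
  (λ v∉Q → mk⇔
    (λ (size , Q⊆S , clique) → size , (λ x∈Q → x∈p∧x≢y⇒x∈p-y (Q⊆S x∈Q) λ { refl → v∉Q x∈Q }) , clique)
    (λ (size , Q⊆ , clique) → size , (λ x∈Q → proj₁ (x∈p-y⁻ S v (Q⊆ x∈Q))) , clique))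
  (λ {Q} v∉Q → mk⇔
    (λ (size , Q⊆S , clique) →
      suc-injective (trans (sym (∣p⊕x∣≡1+∣p∣ Q v v∉Q)) size) ,
      (λ {x} x∈Q → x∈p∩q⁺ (Q⊆S (p⊆p⊕x v x∈Q) ,
         from (∈N {G = G}) (clique v (x∈p⊕x Q v) x (p⊆p⊕x v x∈Q) λ { refl → v∉Q x∈Q }))) ,
      IsClique-⊆ {G = G} (p⊆p⊕x v) clique)
    (λ (size , Q⊆ , clique) →
      trans (∣p⊕x∣≡1+∣p∣ Q v v∉Q) (cong suc size) ,
      (λ x∈ → ⊕⊆ Q⊆ (x∈p⊕y⁻ Q v x∈)) ,
      IsClique-⊕ G v (p∩q⊆q S _ ∘ Q⊆) clique))
  where
  ⊕⊆ : ∀ {Q x} → Q ⊆ S ∩ N G v → x ≡ v ⊎ x ∈ Q → x ∈ S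
  ⊕⊆ Q⊆ (inj₁ refl) = v∈S
  ⊕⊆ Q⊆ (inj₂ x∈Q) = p∩q⊆p S _ (Q⊆ x∈Q)

-- The degree, into T_r(i), of a vertex added to a smallest part of T_r(i).
turánDegree : (r : ℕ) → .{{_ : ℕ.NonZero r}} → ℕ → ℕ
turánDegree r i = i ∸ i ℕ./ r

-- k^t(T_r(n)), computed by deleting a vertex of a largest part.
turánCliques : (r t n : ℕ) → ℕ
turánCliques r zero n = 1
turánCliques r (suc t) zero = 0
-- No Turán graph has vertices but no parts; 0 is a default value.
turánCliques zero (suc t) (suc n) = 0
turánCliques (suc r) (suc t) (suc n) = turánCliques (suc r) (suc t) n + turánCliques r t (turánDegree (suc r) n)

turánCliques-mono-≤ : ∀ r t {m n} → m ≤ n → turánCliques r t m ≤ turánCliques r t n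
turánCliques-mono-≤ r zero _ = ≤-refl
turánCliques-mono-≤ r (suc t) {zero} _ = z≤n
turánCliques-mono-≤ zero (suc t) {suc m} _ = z≤n
turánCliques-mono-≤ (suc r) (suc t) {suc m} {suc n} (s≤s m≤n) with m≤n⇒m<n∨m≡n m≤n
... | inj₂ refl = ≤-refl
... | inj₁ m<n = ≤-trans (turánCliques-mono-≤ (suc r) (suc t) m<n) (m≤m+n _ _)

CliqueFreeOn : Graph n → ℕ → Subset n → Set
CliqueFreeOn G s S = ∀ Q → ¬ IsCliqueIn G s S Q

free-⊆ : {s : ℕ} {S S′ : Subset n} → S′ ⊆ S → CliqueFreeOn G s S → CliqueFreeOn G s S′
free-⊆ S′⊆S free Q (size , Q⊆S′ , clique) = free Q (size , S′⊆S ∘ Q⊆S′ , clique)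

free-N : (G : Graph n) {s : ℕ} {S : Subset n} {v : Fin n} → v ∈ S →
  CliqueFreeOn G (suc s) S → CliqueFreeOn G s (S ∩ N G v)
free-N G {S = S} {v} v∈S free Q (size , Q⊆ , clique) = free (Q ⊕ v)
  ( trans (∣p⊕x∣≡1+∣p∣ Q v (λ v∈Q → v∉Nv G v (p∩q⊆q S _ (Q⊆ v∈Q)))) (cong suc size)
  , (λ x∈ → ⊕⊆ (x∈p⊕y⁻ Q v x∈))
  , IsClique-⊕ G v (p∩q⊆q S _ ∘ Q⊆) clique )
  where
  ⊕⊆ : ∀ {x} → x ≡ v ⊎ x ∈ Q → x ∈ S
  ⊕⊆ (inj₁ refl) = v∈S
  ⊕⊆ (inj₂ x∈Q) = p∩q⊆p S _ (Q⊆ x∈Q)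

free-one⇒empty : (G : Graph n) {S : Subset n} → CliqueFreeOn G 1 S → ∣ S ∣ ≡ 0
free-one⇒empty {n} G {S} free with ∣ S ∣ in eq
... | zero = refl
... | suc _ =
  -- For `v` in `S`, `⊥` is a 0-clique in the neighbourhood of `v`, which `free-N` excludes.
  let v , v∈S = 0<∣p∣⇒Nonempty S (subst (0 <_) (sym eq) (s≤s z≤n)) in
  contradiction (⊥-clique G (S ∩ N G v)) (free-N G v∈S free ⊥)

-- Each step of a greedy clique construction loses at most q candidates.
fewNonneighbors⇒small : (G : Graph n) (r q : ℕ) {S : Subset n} →
  (∀ {v} → v ∈ S → ∣ S ∩ ∁ (N G v) ∣ ≤ q) → CliqueFreeOn G (suc r) S → ∣ S ∣ ≤ r * q
fewNonneighbors⇒small G zero q few free = ≤-reflexive (free-one⇒empty G free)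
fewNonneighbors⇒small G (suc r) q {S} few free with ∣ S ∣ in eq
... | zero = z≤n
... | suc _ with v , v∈S ← 0<∣p∣⇒Nonempty S (subst (0 <_) (sym eq) (s≤s z≤n)) = begin
  suc _                              ≡⟨ eq ⟨
  ∣ S ∣                              ≡⟨ ∣p∩q∣+∣p∩∁q∣≡∣p∣ S (N G v) ⟨
  ∣ S ∩ N G v ∣ + ∣ S ∩ ∁ (N G v) ∣  ≤⟨ +-mono-≤ ih (few v∈S) ⟩
  r * q + q                          ≡⟨ +-comm (r * q) q ⟩
  q + r * q                          ∎
  where
  open ≤-Reasoning
  ih : ∣ S ∩ N G v ∣ ≤ r * q
  ih = fewNonneighbors⇒small G r q
    (λ {u} u∈ → ≤-trans (p⊆q⇒∣p∣≤∣q∣ {p = (S ∩ N G v) ∩ ∁ (N G u)} {q = S ∩ ∁ (N G u)} λ x∈ →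
      let x∈SN , x∈∁ = x∈p∩q⁻ (S ∩ N G v) _ x∈ in x∈p∩q⁺ (p∩q⊆p S _ x∈SN , x∈∁))
      (few (p∩q⊆p S _ u∈)))
    (free-N G v∈S free)

-- If every degree within `S` exceeded m - q with q = ⌊m/(r+1)⌋, each vertex would have at most q
-- non-neighbours in `S`, itself included, and `fewNonneighbors⇒small` would give m + 1 ≤ (r+1)q ≤
-- m.
minDegree : (G : Graph n) {S : Subset n} → ∣ S ∣ ≡ suc m → CliqueFreeOn G (2 + r) S →
  ∃[ v ] v ∈ S × ∣ S ∩ N G v ∣ ≤ turánDegree (suc r) m
minDegree {m = m} {r} G {S} ∣S∣≡1+m free
  with any? (λ v → (v ∈? S) ×-dec (∣ S ∩ N G v ∣ ≤? turánDegree (suc r) m))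
... | yes found = found
... | no none = contradiction (≤-<-trans small (s≤s (≤-trans (≤-reflexive (*-comm (suc r) q)) (m/n*n≤m m (suc r))))) (<-irrefl ∣S∣≡1+m)
  where
  q = m ℕ./ suc r
  q≤m : q ≤ m
  q≤m = ≤-trans (m≤m*n q (suc r)) (m/n*n≤m m (suc r))
  few : ∀ {v} → v ∈ S → ∣ S ∩ ∁ (N G v) ∣ ≤ q
  few {v} v∈S = +-cancelˡ-≤ (suc (m ∸ q)) _ _ (begin
    suc (m ∸ q) + ∣ S ∩ ∁ (N G v) ∣    ≤⟨ +-monoˡ-≤ _ (≰⇒> λ d≤ → none (v , v∈S , d≤)) ⟩
    ∣ S ∩ N G v ∣ + ∣ S ∩ ∁ (N G v) ∣  ≡⟨ ∣p∩q∣+∣p∩∁q∣≡∣p∣ S (N G v) ⟩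
    ∣ S ∣                              ≡⟨ ∣S∣≡1+m ⟩
    suc m                              ≡⟨ cong suc (m∸n+n≡m q≤m) ⟨
    suc (m ∸ q) + q                    ∎)
    where open ≤-Reasoning
  small : ∣ S ∣ ≤ suc r * q
  small = fewNonneighbors⇒small G (suc r) q few free

∣S-v∣ : {S : Subset n} {v : Fin n} → v ∈ S → ∣ S ∣ ≡ suc m → ∣ S - v ∣ ≡ m
∣S-v∣ v∈S ∣S∣≡1+m = suc-injective (trans (x∈p⇒1+∣p-x∣≡∣p∣ v∈S) ∣S∣≡1+m)

-- The vertex given by `minDegree` is deleted. Its neighbourhood is free of cliques one smaller, and
-- the inductive bounds for the two terms add up to the recursion of `turánCliques`.
zykov : (G : Graph n) (r t m : ℕ) {S : Subset n} → ∣ S ∣ ≡ m → CliqueFreeOn G (suc r) S →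
  cliques G t S ≤ turánCliques r t m
zykov G r zero m {S} _ _ = ≤-reflexive (cliques-zero G S)
zykov G r (suc t) zero ∣S∣≡0 _ = ≤-reflexive (cliques-empty G t ∣S∣≡0)
zykov G zero (suc t) (suc m) ∣S∣≡1+m free =
  contradiction (trans (sym ∣S∣≡1+m) (free-one⇒empty G free)) λ ()
zykov G (suc r) (suc t) (suc m) {S} ∣S∣≡1+m free =
  let v , v∈S , small = minDegree G ∣S∣≡1+m free in begin
  cliques G (suc t) S
    ≡⟨ cliques-delete G t v∈S ⟩
  cliques G (suc t) (S - v) + cliques G t (S ∩ N G v)
    ≤⟨ +-mono-≤
         (zykov G (suc r) (suc t) m (∣S-v∣ v∈S ∣S∣≡1+m) (free-⊆ {G = G} (proj₁ ∘ x∈p-y⁻ S v) free))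
         (≤-trans (zykov G r t _ refl (free-N G v∈S free)) (turánCliques-mono-≤ r t small)) ⟩
  turánCliques (suc r) (suc t) (suc m) ∎
  where open ≤-Reasoning

-- A vertex of `L` has at most `d` neighbours in `G`, hence in whatever remains of `S`, so by
-- `zykov` its deletion destroys at most `turánCliques r t d` cliques. After `j` deletions `zykov`
-- bounds the rest.
delete-low : (G : Graph n) (r t d j m : ℕ) {S L : Subset n} → CliqueFreeOn G (2 + r) S →
  L ⊆ S → (∀ {v} → v ∈ L → deg G v ≤ d) → j ≤ ∣ L ∣ → ∣ S ∣ ≡ m + j →
  cliques G (suc t) S ≤ turánCliques (suc r) (suc t) m + j * turánCliques r t d
delete-low G r t d zero m free _ _ _ ∣S∣≡ = ≤-trans
  (zykov G (suc r) (suc t) m (trans ∣S∣≡ (+-identityʳ m)) free) (m≤m+n _ _)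
delete-low G r t d (suc j) m {S} {L} free L⊆S low j<∣L∣ ∣S∣≡
  with v , v∈L ← 0<∣p∣⇒Nonempty L (≤-trans (s≤s z≤n) j<∣L∣) = begin
  cliques G (suc t) S
    ≡⟨ cliques-delete G t v∈S ⟩
  cliques G (suc t) (S - v) + cliques G t (S ∩ N G v)
    ≤⟨ +-mono-≤ ih (≤-trans (zykov G r t _ refl (free-N G v∈S free)) (turánCliques-mono-≤ r t small)) ⟩
  (K + j * g) + g
    ≡⟨ +-assoc K (j * g) g ⟩
  K + (j * g + g)
    ≡⟨ cong (K +_) (+-comm (j * g) g) ⟩
  K + suc j * g ∎
  where
  open ≤-Reasoning
  K = turánCliques (suc r) (suc t) m
  g = turánCliques r t d
  v∈S = L⊆S v∈L
  small : ∣ S ∩ N G v ∣ ≤ d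
  small = ≤-trans (∣p∩q∣≤∣q∣ S (N G v)) (low v∈L)
  ih : cliques G (suc t) (S - v) ≤ K + j * g
  ih = delete-low G r t d j m {L = L - v} (free-⊆ {G = G} (proj₁ ∘ x∈p-y⁻ S v) free)
    (λ x∈ → let x∈L , x≢v = x∈p-y⁻ L v x∈ in x∈p∧x≢y⇒x∈p-y (L⊆S x∈L) x≢v)
    (λ x∈ → low (proj₁ (x∈p-y⁻ L v x∈)))
    (s≤s⁻¹ (subst (suc j ≤_) (sym (x∈p⇒1+∣p-x∣≡∣p∣ v∈L)) j<∣L∣))
    (∣S-v∣ v∈S (trans ∣S∣≡ (+-suc m j)))

maximize : {P : Pred (Fin n) 0ℓ} (P? : Decidable P) (f : Fin n → ℕ) → ∃[ i ] P i →
  ∃[ i ] P i × (∀ {j} → P j → f j ≤ f i)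
maximize {n} P? f (i₀ , Pi₀) = argmax f i₀ candidates ,
  argmax-all f Pi₀ (all-filter P? (allFin n)) ,
  λ Pj → All.lookup (f[xs]≤f[argmax] {f = f} i₀ candidates) (∈-filter⁺ P? (∈-allFin _) Pj)
  where candidates = filter P? (allFin n)

-- The set `C` of available colours can shrink while `c` stays fixed, since the neighbourhood of a
-- vertex loses one part. Empty parts with colours in `C` count for the balance.
record TuránOn (G : Graph n) (S : Subset n) (c : Fin n → Fin r) (C : Subset r) : Set where
  field
    colors       : ∀ {v} → v ∈ S → c v ∈ C
    multipartite : ∀ {u v} → u ∈ S → v ∈ S → Adj G u v ⇔ (c u ≢ c v)
    balanced     : ∀ {i j} → i ∈ C → j ∈ C → ∣ S ∩ part c i ∣ ≤ suc ∣ S ∩ part c j ∣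
open TuránOn

parts-large⇒large : {c : Fin n → Fin r} (q m : ℕ) {S : Subset n} {C : Subset r} → ∣ C ∣ ≡ m →
  (∀ {i} → i ∈ C → q ≤ ∣ S ∩ part c i ∣) → m * q ≤ ∣ S ∣
parts-large⇒large q zero _ _ = z≤n
parts-large⇒large {c = c} q (suc m) {S} {C} ∣C∣≡ large
  with i , i∈C ← 0<∣p∣⇒Nonempty C (subst (0 <_) (sym ∣C∣≡) (s≤s z≤n)) = begin
  q + m * q                                    ≤⟨ +-mono-≤ (large i∈C) ih ⟩
  ∣ S ∩ part c i ∣ + ∣ S ∩ ∁ (part c i) ∣      ≡⟨ ∣p∩q∣+∣p∩∁q∣≡∣p∣ S (part c i) ⟩
  ∣ S ∣                                        ∎
  where
  open ≤-Reasoning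
  ih : m * q ≤ ∣ S ∩ ∁ (part c i) ∣
  ih = parts-large⇒large {c = c} q m {S ∩ ∁ (part c i)} {C - i} (∣S-v∣ i∈C ∣C∣≡) λ {j} j∈ →
    let j∈C , j≢i = x∈p-y⁻ C i j∈ in
    ≤-trans (large j∈C) (p⊆q⇒∣p∣≤∣q∣ {p = S ∩ part c j} {q = (S ∩ ∁ (part c i)) ∩ part c j} λ {x} x∈ →
      let x∈S , x∈j = x∈p∩q⁻ S _ x∈
          cx≡j = to (∈-part c) x∈j in
      x∈p∩q⁺ (x∈p∩q⁺ (x∈S , x∉p⇒x∈∁p λ x∈i → j≢i (trans (sym cx≡j) (to (∈-part c) x∈i))) , x∈j))

record LargestPartVertex (G : Graph n) (c : Fin n → Fin r) (s m : ℕ) (S : Subset n) (C : Subset r) : Set where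
  field
    v        : Fin n
    v∈S      : v ∈ S
    C′       : Subset r
    ∣C′∣     : ∣ C′ ∣ ≡ s
    turán-S-v  : TuránOn G (S - v) c C
    turán-S∩N  : TuránOn G (S ∩ N G v) c C′
    degree   : turánDegree (suc s) m ≤ ∣ S ∩ N G v ∣

-- A vertex `v` of a largest part `i` is deleted. In `S - v` that part is a smallest one, so its
-- size is at most m/(s+1), and the neighbourhood of `v` in `S` is everything outside part `i`.
largestPartVertex : (G : Graph n) (c : Fin n → Fin r) (s m : ℕ) {S : Subset n} {C : Subset r} →
  ∣ C ∣ ≡ suc s → ∣ S ∣ ≡ suc m → TuránOn G S c C → LargestPartVertex G c s m S C
largestPartVertex G c s m {S} {C} ∣C∣≡ ∣S∣≡ T
  with u , u∈S ← 0<∣p∣⇒Nonempty S (subst (0 <_) (sym ∣S∣≡) (s≤s z≤n))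
  with i , i∈C , largest ← maximize (_∈? C) (λ i → ∣ S ∩ part c i ∣) (c u , colors T u∈S)
  with v , v∈ ← 0<∣p∣⇒Nonempty (S ∩ part c i)
    (≤-trans (x∈p⇒0<∣p∣ {p = S ∩ part c (c u)} (x∈p∩q⁺ (u∈S , from (∈-part c) refl))) (largest (colors T u∈S)))
  = record
    { v = v ; v∈S = v∈S ; C′ = C - i ; ∣C′∣ = ∣S-v∣ i∈C ∣C∣≡
    ; turán-S-v = T-v ; turán-S∩N = T-N ; degree = degree }
  where
  open ≤-Reasoning
  v∈S : v ∈ S
  v∈S = proj₁ (x∈p∩q⁻ S _ v∈)
  cv≡i : c v ≡ i
  cv≡i = to (∈-part c) (proj₂ (x∈p∩q⁻ S _ v∈))
  ∣S-v∣≡ = ∣S-v∣ v∈S ∣S∣≡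
  part-v : ∀ {j} → (S - v) ∩ part c j ⊆ S ∩ part c j
  part-v x∈ = let x∈S-v , x∈j = x∈p∩q⁻ (S - v) _ x∈ in x∈p∩q⁺ (proj₁ (x∈p-y⁻ S v x∈S-v) , x∈j)
  part≤ : ∀ j → ∣ (S - v) ∩ part c j ∣ ≤ ∣ S ∩ part c j ∣
  part≤ j = p⊆q⇒∣p∣≤∣q∣ (part-v {j})
  part-i : suc ∣ (S - v) ∩ part c i ∣ ≤ ∣ S ∩ part c i ∣
  part-i = p⊂q⇒∣p∣<∣q∣ ((λ {x} → part-v {i} {x}) , v , v∈ , λ v∈′ → x∉p-x S v (p∩q⊆p (S - v) _ v∈′))
  part-i≤ : ∣ S ∩ part c i ∣ ≤ suc ∣ (S - v) ∩ part c i ∣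
  part-i≤ = subst (_≤ suc ∣ (S - v) ∩ part c i ∣) (x∈p⇒1+∣p-x∣≡∣p∣ v∈) (s≤s (p⊆q⇒∣p∣≤∣q∣ {p = (S ∩ part c i) - v} {q = (S - v) ∩ part c i} λ x∈ →
    let x∈Si , x≢v = x∈p-y⁻ (S ∩ part c i) v x∈
        x∈S , x∈i = x∈p∩q⁻ S _ x∈Si in
    x∈p∩q⁺ (x∈p∧x≢y⇒x∈p-y x∈S x≢v , x∈i)))
  part-j≤ : ∀ {j} → j ≢ i → ∣ S ∩ part c j ∣ ≤ ∣ (S - v) ∩ part c j ∣
  part-j≤ {j} j≢i = p⊆q⇒∣p∣≤∣q∣ {p = S ∩ part c j} {q = (S - v) ∩ part c j} λ x∈ →
    let x∈S , x∈j = x∈p∩q⁻ S _ x∈ in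
    x∈p∩q⁺ (x∈p∧x≢y⇒x∈p-y x∈S (λ { refl → j≢i (trans (sym (to (∈-part c) x∈j)) cv≡i) }) , x∈j)
  balanced-v : ∀ {j l} → j ∈ C → l ∈ C → ∣ (S - v) ∩ part c j ∣ ≤ suc ∣ (S - v) ∩ part c l ∣
  balanced-v {j} {l} j∈C l∈C with l ≟ i
  ... | yes refl = ≤-trans (part≤ j) (≤-trans (largest j∈C) part-i≤)
  ... | no l≢i = ≤-trans (part≤ j) (≤-trans (balanced T j∈C l∈C) (s≤s (part-j≤ l≢i)))
  T-v : TuránOn G (S - v) c C
  T-v .colors x∈ = colors T (proj₁ (x∈p-y⁻ S v x∈))
  T-v .multipartite x∈ y∈ = multipartite T (proj₁ (x∈p-y⁻ S v x∈)) (proj₁ (x∈p-y⁻ S v y∈))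
  T-v .balanced = balanced-v
  q = ∣ (S - v) ∩ part c i ∣
  part-large : ∀ {j} → j ∈ C → q ≤ ∣ (S - v) ∩ part c j ∣
  part-large {j} j∈C with j ≟ i
  ... | yes refl = ≤-refl
  ... | no j≢i = ≤-trans (s≤s⁻¹ (≤-trans part-i (balanced T i∈C j∈C))) (part-j≤ j≢i)
  q≤m/s : q ≤ m ℕ./ suc s
  q≤m/s = begin
    q                    ≡⟨ m*n/n≡m q (suc s) ⟨
    q * suc s ℕ./ suc s    ≤⟨ /-monoˡ-≤ (suc s) (begin
      q * suc s ≡⟨ *-comm q (suc s) ⟩
      suc s * q ≤⟨ parts-large⇒large {c = c} q (suc s) {S - v} ∣C∣≡ part-large ⟩
      ∣ S - v ∣ ≡⟨ ∣S-v∣≡ ⟩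
      m ∎) ⟩
    m ℕ./ suc s            ∎
  N⇔ : ∀ {x} → x ∈ S ∩ N G v ⇔ (x ∈ S × c x ≢ i)
  N⇔ {x} = mk⇔
    (λ x∈ → let x∈S , x∈N = x∈p∩q⁻ S _ x∈ in
      x∈S , λ cx≡i → to (multipartite T v∈S x∈S) (to (∈N {G = G}) x∈N) (trans cv≡i (sym cx≡i)))
    (λ (x∈S , cx≢i) → x∈p∩q⁺ (x∈S , from (∈N {G = G})
      (from (multipartite T v∈S x∈S) λ cv≡cx → cx≢i (trans (sym cv≡cx) cv≡i))))
  degree : turánDegree (suc s) m ≤ ∣ S ∩ N G v ∣
  degree = begin
    m ∸ m ℕ./ suc s               ≤⟨ ∸-monoʳ-≤ m q≤m/s ⟩
    m ∸ q                       ≡⟨⟩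
    suc m ∸ suc q               ≤⟨ ∸-monoʳ-≤ (suc m) part-i≤ ⟩
    suc m ∸ p                   ≡⟨ cong (_∸ p) (trans (sym ∣S∣≡) (sym (∣p∩q∣+∣p∩∁q∣≡∣p∣ S (part c i)))) ⟩
    p + ∣ S ∩ ∁ (part c i) ∣ ∸ p ≡⟨ m+n∸m≡n p _ ⟩
    ∣ S ∩ ∁ (part c i) ∣        ≤⟨ p⊆q⇒∣p∣≤∣q∣ {p = S ∩ ∁ (part c i)} {q = S ∩ N G v} (λ x∈ →
       let x∈S , x∈∁ = x∈p∩q⁻ S _ x∈ in from N⇔ (x∈S , x∈∁p⇒x∉p x∈∁ ∘ from (∈-part c))) ⟩
    ∣ S ∩ N G v ∣               ∎
    where p = ∣ S ∩ part c i ∣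
  part-N : ∀ {j} → j ≢ i → ∣ (S ∩ N G v) ∩ part c j ∣ ≡ ∣ S ∩ part c j ∣
  part-N {j} j≢i = ≤-antisym
    (p⊆q⇒∣p∣≤∣q∣ {p = SNj} {q = Sj} λ x∈ → let x∈SN , x∈j = x∈p∩q⁻ (S ∩ N G v) _ x∈ in x∈p∩q⁺ (p∩q⊆p S _ x∈SN , x∈j))
    (p⊆q⇒∣p∣≤∣q∣ {p = Sj} {q = SNj} λ x∈ → let x∈S , x∈j = x∈p∩q⁻ S _ x∈ in
      x∈p∩q⁺ (from N⇔ (x∈S , λ cx≡i → j≢i (trans (sym (to (∈-part c) x∈j)) cx≡i)) , x∈j))
    where
    Sj = S ∩ part c j
    SNj = (S ∩ N G v) ∩ part c j
  T-N : TuránOn G (S ∩ N G v) c (C - i)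
  T-N .colors x∈ = let x∈S , cx≢i = to N⇔ x∈ in x∈p∧x≢y⇒x∈p-y (colors T x∈S) cx≢i
  T-N .multipartite x∈ y∈ = multipartite T (p∩q⊆p S _ x∈) (p∩q⊆p S _ y∈)
  T-N .balanced {j} {l} j∈ l∈ =
    let j∈C , j≢i = x∈p-y⁻ C i j∈
        l∈C , l≢i = x∈p-y⁻ C i l∈ in
    subst (_≤ suc ∣ (S ∩ N G v) ∩ part c l ∣) (sym (part-N j≢i))
      (subst (λ z → ∣ S ∩ part c j ∣ ≤ suc z) (sym (part-N l≢i)) (balanced T j∈C l∈C))

-- `largestPartVertex` supplies a vertex whose deletion follows the recursion of `turánCliques`,
-- with at least as many neighbours as that prescribes.
turán-cliques : (G : Graph n) (c : Fin n → Fin r) (s t m : ℕ) {S : Subset n} {C : Subset r} →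
  ∣ C ∣ ≡ s → ∣ S ∣ ≡ m → TuránOn G S c C → turánCliques s t m ≤ cliques G t S
turán-cliques G c s zero m {S} _ _ _ = ≤-reflexive (sym (cliques-zero G S))
turán-cliques G c s (suc t) zero _ _ _ = z≤n
turán-cliques G c zero (suc t) (suc m) _ _ _ = z≤n
turán-cliques G c (suc s) (suc t) (suc m) {S} ∣C∣≡ ∣S∣≡ T =
  let open LargestPartVertex (largestPartVertex G c s m ∣C∣≡ ∣S∣≡ T) in begin
  turánCliques (suc s) (suc t) (suc m)
    ≤⟨ +-mono-≤ (turán-cliques G c (suc s) (suc t) m ∣C∣≡ (∣S-v∣ v∈S ∣S∣≡) turán-S-v)
                (≤-trans (turánCliques-mono-≤ s t degree) (turán-cliques G c s t _ ∣C′∣ refl turán-S∩N)) ⟩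
  cliques G (suc t) (S - v) + cliques G t (S ∩ N G v)
    ≡⟨ cliques-delete G t v∈S ⟨
  cliques G (suc t) S ∎
  where open ≤-Reasoning

-- The closure and G^{ℓ*}_{n,r}

sum-tabulate-mono-≤ : {f g : Fin n → ℕ} → (∀ i → f i ≤ g i) → sum (tabulate f) ≤ sum (tabulate g)
sum-tabulate-mono-≤ {n = zero} f≤g = z≤n
sum-tabulate-mono-≤ {n = suc n} f≤g = +-mono-≤ (f≤g zero) (sum-tabulate-mono-≤ (f≤g ∘ suc))

sum-tabulate-mono-< : {f g : Fin n → ℕ} → (∀ i → f i ≤ g i) → (i : Fin n) → f i < g i →
  sum (tabulate f) < sum (tabulate g)
sum-tabulate-mono-< f≤g zero fi<gi = +-mono-<-≤ fi<gi (sum-tabulate-mono-≤ (f≤g ∘ suc))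
sum-tabulate-mono-< f≤g (suc i) fi<gi = +-mono-≤-< (f≤g zero) (sum-tabulate-mono-< (f≤g ∘ suc) i fi<gi)

-- Termination measure for the closure: ordered non-adjacent pairs, the diagonal included.
nonAdjacencies : Graph n → ℕ
nonAdjacencies G = sum (tabulate λ v → ∣ ∁ (N G v) ∣)

module _ (G : Graph n) {u v : Fin n} (u≢v : u ≢ v) where

  N⊆N-addEdge : ∀ w → N G w ⊆ N (addEdge G u≢v) w
  N⊆N-addEdge w x∈ = from (∈N {G = addEdge G u≢v}) (from T-∨ (inj₁ (to (∈N {G = G}) x∈)))

  deg≤deg-addEdge : ∀ w → deg G w ≤ deg (addEdge G u≢v) w
  deg≤deg-addEdge w = p⊆q⇒∣p∣≤∣q∣ (N⊆N-addEdge w)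

  addEdge-Adj : Adj (addEdge G u≢v) u v
  addEdge-Adj with u ≟ u | v ≟ v
  ... | yes _ | yes _ = from (T-∨ {adj G u v}) (inj₂ _)
  ... | no u≢u | _ = contradiction refl u≢u
  ... | _ | no v≢v = contradiction refl v≢v

  nonAdjacencies-addEdge : ¬ Adj G u v → nonAdjacencies (addEdge G u≢v) < nonAdjacencies G
  nonAdjacencies-addEdge ¬uv = sum-tabulate-mono-<
    (λ w → p⊆q⇒∣p∣≤∣q∣ (p⊆q⇒∁p⊇∁q (N⊆N-addEdge w))) u
    (p⊂q⇒∣p∣<∣q∣ (p⊂q⇒∁p⊃∁q (N⊆N-addEdge u , v , from (∈N {G = addEdge G u≢v}) addEdge-Adj ,
      ¬uv ∘ to (∈N {G = G}))))

-- With `a` = ℓ + 1 and s = `∣ S ∣`, the last two conditions read d < ℓ + 1 + s and 2d ≤ n + ℓ - 1.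
record LowDegreeSet (G : Graph n) (a : ℕ) : Set where
  field
    d        : ℕ
    S        : Subset n
    deg≤d    : ∀ {v} → v ∈ S → deg G v ≤ d
    nonempty : 0 < ∣ S ∣
    large    : d < a + ∣ S ∣
    d-small  : 2 + (d + d) ≤ n + a

-- Adding an edge lowers no degree, so the set found in the closure serves in the original graph.
lowDegreeSet-addEdge : {a : ℕ} (G : Graph n) {u v : Fin n} (u≢v : u ≢ v) →
  LowDegreeSet (addEdge G u≢v) a → LowDegreeSet G a
lowDegreeSet-addEdge G u≢v low = record
  { LowDegreeSet low
  ; deg≤d = λ {w} w∈S → ≤-trans (deg≤deg-addEdge G u≢v w) (LowDegreeSet.deg≤d low w∈S) }

NonAdjacent : Graph n → Fin n → Fin n → Set
NonAdjacent G u v = u ≢ v × ¬ Adj G u v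

nonAdjacent? : (G : Graph n) (u v : Fin n) → Dec (NonAdjacent G u v)
nonAdjacent? G u v = ¬? (u ≟ v) ×-dec ¬? (T? (adj G u v))

NonAdjacent-sym : (G : Graph n) {u v : Fin n} → NonAdjacent G u v → NonAdjacent G v u
NonAdjacent-sym G (u≢v , ¬uv) = u≢v ∘ sym , ¬uv ∘ Adj-sym G

-- Chvátal's argument: take v of maximum degree among the vertices with a non-neighbour;
-- its non-neighbours then all have degree at most that of a largest one, u.
closed⇒lowDegreeSet : {a : ℕ} (G : Graph n) → (∀ {u v} → NonAdjacent G u v → 2 + (deg G u + deg G v) ≤ n + a) →
  ∃[ u ] ∃[ v ] NonAdjacent G u v → LowDegreeSet G a
closed⇒lowDegreeSet {n} {a} G closed (u₀ , v₀ , u₀v₀)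
  with v , (w , wv) , v-max ← maximize (λ v → any? λ u → nonAdjacent? G u v) (deg G) (v₀ , u₀ , u₀v₀)
  with u , uv , u-max ← maximize (λ u → nonAdjacent? G u v) (deg G) (w , wv) = record
  { d = deg G u
  ; S = S
  ; deg≤d = λ x∈S → u-max (S⁻ x∈S)
  ; nonempty = x∈p⇒0<∣p∣ (S⁺ uv)
  -- `S` holds all n - 1 - deg v non-neighbours of `v`, which turns the degree-sum bound into a
  -- lower bound on `∣ S ∣`.
  ; large = +-cancelʳ-≤ (suc (deg G v)) _ _ (begin
      suc (deg G u) + suc (deg G v)      ≡⟨ cong suc (+-suc (deg G u) (deg G v)) ⟩
      2 + (deg G u + deg G v)            ≤⟨ closed uv ⟩
      n + a                              ≡⟨ cong (_+ a) size ⟨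
      ∣ S ∣ + suc (deg G v) + a          ≡⟨ rearrange ∣ S ∣ (suc (deg G v)) a ⟩
      a + ∣ S ∣ + suc (deg G v)          ∎)
  -- `u` has the non-neighbour `v`, so the choice of `v` gives deg u ≤ deg v.
  ; d-small = ≤-trans (s≤s (s≤s (+-monoʳ-≤ (deg G u) (v-max (v , NonAdjacent-sym G uv))))) (closed uv)
  }
  where
  open ≤-Reasoning
  rearrange : ∀ s d a → s + d + a ≡ a + s + d
  rearrange = solve-∀
  S = ∁ (N G v) - v
  S⁻ : ∀ {x} → x ∈ S → NonAdjacent G x v
  S⁻ x∈S = let x∈∁ , x≢v = x∈p-y⁻ (∁ (N G v)) v x∈S in
    x≢v , λ xv → x∈∁p⇒x∉p x∈∁ (from (∈N {G = G}) (Adj-sym G xv))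
  S⁺ : ∀ {x} → NonAdjacent G x v → x ∈ S
  S⁺ (x≢v , ¬xv) = x∈p∧x≢y⇒x∈p-y (x∉p⇒x∈∁p λ x∈N → ¬xv (Adj-sym G (to (∈N {G = G}) x∈N))) x≢v
  size : ∣ S ∣ + suc (deg G v) ≡ n
  size = begin-equality
    ∣ S ∣ + suc (deg G v)         ≡⟨ +-suc ∣ S ∣ (deg G v) ⟩
    suc ∣ S ∣ + deg G v           ≡⟨ cong (_+ deg G v) (x∈p⇒1+∣p-x∣≡∣p∣ {p = ∁ (N G v)} (x∉p⇒x∈∁p (v∉Nv G v))) ⟩
    ∣ ∁ (N G v) ∣ + deg G v       ≡⟨ cong (_+ deg G v) (∣∁p∣≡n∸∣p∣ (N G v)) ⟩
    n ∸ deg G v + deg G v         ≡⟨ m∸n+n≡m (∣p∣≤n (N G v)) ⟩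
    n                             ∎

module _ (a : ℕ) (P : Graph n → Set b)
  (stable : ∀ G u v (u≢v : u ≢ v) → ¬ Adj G u v → P (addEdge G u≢v) → n + a ≤ suc (deg G u + deg G v) → P G)
  (complete : ∀ K → IsComplete K → P K) where

  -- The closure is reached one edge at a time. By stability, joining a non-adjacent pair of degree
  -- sum at least n + ℓ cannot create `P`; when no such pair is left, the graph still lacks `P` and
  -- so is not complete. The `suc` in the bound is there because `a` = ℓ + 1.
  lowDegreeSet-acc : (G : Graph n) → Acc _<_ (nonAdjacencies G) → ¬ P G → LowDegreeSet G a
  lowDegreeSet-acc G (acc rs) ¬PG
    with any? (λ u → any? (λ v → nonAdjacent? G u v ×-dec (n + a ≤? suc (deg G u + deg G v))))
  ... | yes (u , v , (u≢v , ¬uv) , heavy) = lowDegreeSet-addEdge G u≢v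
    (lowDegreeSet-acc (addEdge G u≢v) (rs (nonAdjacencies-addEdge G u≢v ¬uv))
      λ PG+uv → ¬PG (stable G u v u≢v ¬uv PG+uv heavy))
  ... | no closed with any? (λ u → any? (λ v → nonAdjacent? G u v))
  ...   | yes nonAdj = closed⇒lowDegreeSet G (λ {u} {v} uv → ≰⇒> λ heavy → closed (u , v , uv , heavy)) nonAdj
  ...   | no adj = contradiction
    (complete G λ u v u≢v → decidable-stable (T? _) λ ¬uv → adj (u , v , u≢v , ¬uv)) ¬PG

  lowDegreeSet : (G : Graph n) → ¬ P G → LowDegreeSet G a
  lowDegreeSet G = lowDegreeSet-acc G (<-wellFounded _)

injectiveOn⇒∣∣≤ : (c : Fin n → Fin r) (m : ℕ) {Q : Subset n} {C : Subset r} → ∣ C ∣ ≡ m → (∀ {v} → v ∈ Q → c v ∈ C) →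
  (∀ {u v} → u ∈ Q → v ∈ Q → u ≢ v → c u ≢ c v) → ∣ Q ∣ ≤ m
injectiveOn⇒∣∣≤ c m {Q} {C} ∣C∣≡m c∈C inj with ∣ Q ∣ in eq
... | zero = z≤n
... | suc q with v , v∈Q ← 0<∣p∣⇒Nonempty Q (subst (0 <_) (sym eq) (s≤s z≤n)) with m
...   | zero = contradiction (c∈C v∈Q) (∣p∣≡0⇒Empty C ∣C∣≡m)
...   | suc m = s≤s (subst (_≤ m) (∣S-v∣ v∈Q eq) (injectiveOn⇒∣∣≤ c m {Q - v} {C - c v} (∣S-v∣ (c∈C v∈Q) ∣C∣≡m)
    (λ x∈ → let x∈Q , x≢v = x∈p-y⁻ Q v x∈ in x∈p∧x≢y⇒x∈p-y (c∈C x∈Q) (inj x∈Q v∈Q x≢v))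
    (λ x∈ y∈ → inj (proj₁ (x∈p-y⁻ Q v x∈)) (proj₁ (x∈p-y⁻ Q v y∈)))))

colorable⇒KFree : (G : Graph n) (c : Fin n → Fin r) → (∀ u v → Adj G u v → c u ≢ c v) → KFree (suc r) G
colorable⇒KFree {r = r} G c proper (Q , ∣Q∣≡ , clique) = 1+n≰n (subst (_≤ r) ∣Q∣≡
  (injectiveOn⇒∣∣≤ c r (∣⊤∣≡n r) (λ _ → ∈⊤) λ {u} {v} u∈Q v∈Q u≢v → proper u v (clique u u∈Q v v∈Q u≢v)))

IsTuránOn⇒TuránOn : {S : Subset n} {c : Fin n → Fin r} → IsTuránOn G S c → TuránOn G S c ⊤
IsTuránOn⇒TuránOn T = record
  { colors = λ _ → ∈⊤
  ; multipartite = λ u∈S v∈S → IsTuránOn.multipartite T _ _ u∈S v∈S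
  ; balanced = λ _ _ → IsTuránOn.balanced T _ _ }

module _ {ℓ r} (G : Graph n) (gstar : IsGStar ℓ r G) where
  open IsGStar gstar
  open IsTuránOn

  IsGStar⇒KFree : KFree (suc r) G
  IsGStar⇒KFree = colorable⇒KFree G color proper
    where
    -- `x` joins the colour class `i₀`, which its neighbourhood avoids.
    color : Fin n → Fin r
    color v with v ≟ x
    ... | yes _ = i₀
    ... | no _ = c v
    proper : ∀ u v → Adj G u v → color u ≢ color v
    proper u v uv with u ≟ x | v ≟ x
    ... | yes refl | yes refl = contradiction uv (Adj-irrefl G)
    ... | yes refl | no _ = N-avoids v (from (∈N {G = G}) uv) ∘ sym
    ... | no _ | yes refl = N-avoids u (from (∈N {G = G}) (Adj-sym G uv))
    ... | no u≢x | no v≢x = to (multipartite turán u v (∈∁ u≢x) (∈∁ v≢x)) uv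
      where
      ∈∁ : ∀ {w} → w ≢ x → w ∈ ∁ ⁅ x ⁆
      ∈∁ w≢x = x∉p⇒x∈∁p (w≢x ∘ x∈⁅y⁆⇒x≡y x)

  -- Deleting `x` leaves T_r(n-1), and its neighbourhood induces T_(r-1)(ℓ+1), so `turán-cliques`
  -- applies to both terms of `cliques-delete`.
  GStar-cliques : ∀ t →
    turánCliques r (suc t) (n ∸ 1) + turánCliques (r ∸ 1) t ∣ N G x ∣ ≤ k (suc t) G
  GStar-cliques t = begin
    turánCliques r (suc t) (n ∸ 1) + turánCliques (r ∸ 1) t ∣ N G x ∣
      ≤⟨ +-mono-≤
           (turán-cliques G c r (suc t) (n ∸ 1) (∣⊤∣≡n r) (∣S-v∣ {S = ⊤} {x} ∈⊤ (trans (∣⊤∣≡n n) n≡)) T-x)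
           (turán-cliques G c′ (r ∸ 1) t _ (∣⊤∣≡n (r ∸ 1)) (cong ∣_∣ (∩-identityˡ (N G x))) T-N) ⟩
    cliques G (suc t) (⊤ - x) + cliques G t (⊤ ∩ N G x)
      ≡⟨ cliques-delete G t ∈⊤ ⟨
    cliques G (suc t) ⊤
      ≡⟨ k≡cliques-⊤ (suc t) G ⟨
    k (suc t) G ∎
    where
    open ≤-Reasoning
    n≡ : n ≡ suc (n ∸ 1)
    n≡ = sym (suc-pred n {{nonZeroIndex x}})
    T-x : TuránOn G (⊤ - x) c ⊤
    T-x = subst (λ S → TuránOn G S c ⊤) (⊆-antisym
      (λ v∈ → x∈p∧x≢y⇒x∈p-y ∈⊤ (λ { refl → x∈∁p⇒x∉p v∈ (x∈⁅x⁆ x) }))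
      (λ v∈ → x∉p⇒x∈∁p (proj₂ (x∈p-y⁻ ⊤ x v∈) ∘ x∈⁅y⁆⇒x≡y x)))
      (IsTuránOn⇒TuránOn turán)
    T-N : TuránOn G (⊤ ∩ N G x) c′ ⊤
    T-N = subst (λ S → TuránOn G S c′ ⊤) (sym (∩-identityˡ (N G x))) (IsTuránOn⇒TuránOn N-turán)

-- Comparison of clique numbers

-- Reduces an inequality of polynomials to the known A ≤ B by a semiring identity with remainder C ≥ 0.
linear-≤ : ∀ {L R A B} C → A ≤ B → R + A ≡ L + B + C → L ≤ R
linear-≤ {L} {R} {A} {B} C A≤B eq = +-cancelʳ-≤ A L R (begin
  L + A       ≤⟨ +-monoʳ-≤ L A≤B ⟩
  L + B       ≤⟨ m≤m+n (L + B) C ⟩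
  L + B + C   ≡⟨ eq ⟨
  R + A       ∎)
  where open ≤-Reasoning

-- The number of edges that T_r(m+j) has beyond those of T_r(m).
turánDegreeSum : (r m j : ℕ) → .{{_ : ℕ.NonZero r}} → ℕ
turánDegreeSum r m zero = 0
turánDegreeSum r m (suc j) = turánDegreeSum r m j + turánDegree r (m + j)

module _ (g h : ℕ → ℕ) (g-suc : ∀ x → g (suc x) ≡ g x + h x) (h-mono : ∀ {x y} → x ≤ y → h x ≤ h y) where

  open ≤-Reasoning

  tangent-right : ∀ k o → g k + h k * o ≤ g (k + o)
  tangent-right k zero = begin
    g k + h k * 0   ≡⟨ cong (g k +_) (*-zeroʳ (h k)) ⟩
    g k + 0         ≡⟨ +-identityʳ (g k) ⟩
    g k             ≡⟨ cong g (+-identityʳ k) ⟨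
    g (k + 0)       ∎
  tangent-right k (suc o) = begin
    g k + h k * suc o         ≡⟨ rearrange (g k) (h k) o ⟩
    (g k + h k * o) + h k     ≤⟨ +-mono-≤ (tangent-right k o) (h-mono (m≤m+n k o)) ⟩
    g (k + o) + h (k + o)     ≡⟨ g-suc (k + o) ⟨
    g (suc (k + o))           ≡⟨ cong g (+-suc k o) ⟨
    g (k + suc o)             ∎
    where
    rearrange : ∀ x y z → x + y * suc z ≡ (x + y * z) + y
    rearrange = solve-∀

  tangent-left : ∀ b o {k} → b + o ≤ k → g (b + o) ≤ g b + h k * o
  tangent-left b zero _ = begin
    g (b + 0)  ≡⟨ cong g (+-identityʳ b) ⟩
    g b        ≤⟨ m≤m+n (g b) _ ⟩
    g b + _    ∎
  tangent-left b (suc o) {k} b+1+o≤k = begin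
    g (b + suc o)             ≡⟨ cong g (+-suc b o) ⟩
    g (suc (b + o))           ≡⟨ g-suc (b + o) ⟩
    g (b + o) + h (b + o)     ≤⟨ +-mono-≤ (tangent-left b o b+o≤k) (h-mono b+o≤k) ⟩
    (g b + h k * o) + h k     ≡⟨ rearrange (g b) (h k) o ⟩
    g b + h k * suc o         ∎
    where
    b+o≤k = ≤-trans (+-monoʳ-≤ b (n≤1+n o)) b+1+o≤k
    rearrange : ∀ x y z → (x + y * z) + y ≡ x + y * suc z
    rearrange = solve-∀

  -- The difference sequence `h` of `g` is nondecreasing, so `g` is convex and lies above its
  -- tangent of slope `h k` at `k` on both sides. Terms are moved across to avoid subtraction.
  tangent : ∀ k b → g k + h k * b ≤ g b + h k * k
  tangent k b with ≤-total k b
  ... | inj₁ k≤b with o , refl ← m≤n⇒∃[o]m+o≡n k≤b =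
    linear-≤ 0 (tangent-right k o) (rearrange (g k) (g (k + o)) (h k) k o)
    where
    rearrange : ∀ x y z k o → (y + z * k) + (x + z * o) ≡ (x + z * (k + o)) + y + 0
    rearrange = solve-∀
  ... | inj₂ b≤k with o , refl ← m≤n⇒∃[o]m+o≡n b≤k =
    linear-≤ 0 (tangent-left b o ≤-refl) (rearrange (g b) (g (b + o)) (h (b + o)) b o)
    where
    rearrange : ∀ x y z b o → (x + z * (b + o)) + y ≡ (y + z * b) + (x + z * o) + 0
    rearrange = solve-∀

turánDegree-suc : ∀ r i → .{{_ : ℕ.NonZero r}} → turánDegree r i ≤ turánDegree r (suc i)
turánDegree-suc r@(suc ρ) i = ∸-monoʳ-≤ (suc i) (begin
  suc i ℕ./ r      ≤⟨ /-monoˡ-≤ r (subst (suc i ≤_) (sym (+-suc i ρ)) (s≤s (m≤m+n i ρ))) ⟩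
  (i + r) ℕ./ r    ≡⟨ +-distrib-/-∣ʳ i ∣-refl ⟩
  i ℕ./ r + r ℕ./ r  ≡⟨ cong (i ℕ./ r +_) (n/n≡1 r) ⟩
  i ℕ./ r + 1      ≡⟨ +-comm (i ℕ./ r) 1 ⟩
  suc (i ℕ./ r)    ∎)
  where open ≤-Reasoning

turánDegree-mono-≤ : ∀ r → .{{_ : ℕ.NonZero r}} → ∀ {x y} → x ≤ y → turánDegree r x ≤ turánDegree r y
turánDegree-mono-≤ r {x} {zero} z≤n = ≤-refl
turánDegree-mono-≤ r {x} {suc y} x≤1+y with m≤n⇒m<n∨m≡n x≤1+y
... | inj₂ refl = ≤-refl
... | inj₁ (s≤s x≤y) = ≤-trans (turánDegree-mono-≤ r x≤y) (turánDegree-suc r y)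

-- Convexity of d ↦ k^t(T_(r+1)(d)) reduces the comparison to the case of edges.
turánCliques-exchange : ∀ r t m j a d → suc j * d ≤ a + turánDegreeSum (2 + r) m j →
  turánCliques (2 + r) (2 + t) m + suc j * turánCliques (suc r) (suc t) d
    ≤ turánCliques (2 + r) (2 + t) (m + j) + turánCliques (suc r) (suc t) a
-- The common summand replaces a subtraction. The tangent at `d` is used once at `a` and, in `sums`,
-- once at the degree of each vertex put back; `bound` then compares the slope terms.
turánCliques-exchange r t m j a d bound = +-cancelʳ-≤ (h d * (a + Σ)) _ _ (begin
  (K m + suc j * g d) + h d * (a + Σ)
    ≡⟨ rearrange₁ (K m) j (g d) (h d) a Σ ⟩
  (K m + (j * g d + h d * Σ)) + (g d + h d * a)
    ≤⟨ +-mono-≤ (sums j) (tangent′ a) ⟩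
  (K (m + j) + h d * (j * d)) + (g a + h d * d)
    ≡⟨ rearrange₂ (K (m + j)) (h d) j d (g a) ⟩
  (K (m + j) + g a) + h d * (suc j * d)
    ≤⟨ +-monoʳ-≤ (K (m + j) + g a) (*-monoʳ-≤ (h d) bound) ⟩
  (K (m + j) + g a) + h d * (a + Σ) ∎)
  where
  open ≤-Reasoning
  K g h : ℕ → ℕ
  K = turánCliques (2 + r) (2 + t)
  g = turánCliques (suc r) (suc t)
  h x = turánCliques r t (turánDegree (suc r) x)
  Σ = turánDegreeSum (2 + r) m j
  rearrange₁ : ∀ x j y z a s → (x + suc j * y) + z * (a + s) ≡ (x + (j * y + z * s)) + (y + z * a)
  rearrange₁ = solve-∀
  rearrange₂ : ∀ x z j d y → (x + z * (j * d)) + (y + z * d) ≡ (x + y) + z * (suc j * d)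
  rearrange₂ = solve-∀
  tangent′ : ∀ b → g d + h d * b ≤ g b + h d * d
  tangent′ = tangent g h (λ _ → refl) (λ x≤y → turánCliques-mono-≤ r t (turánDegree-mono-≤ (suc r) x≤y)) d
  sums : ∀ j → K m + (j * g d + h d * turánDegreeSum (2 + r) m j) ≤ K (m + j) + h d * (j * d)
  sums zero = ≤-reflexive (cong₂ _+_ (cong K (sym (+-identityʳ m))) refl)
  sums (suc j) = begin
    K m + (suc j * g d + h d * (Σj + D))
      ≡⟨ rearrange₃ (K m) j (g d) (h d) Σj D ⟩
    (K m + (j * g d + h d * Σj)) + (g d + h d * D)
      ≤⟨ +-mono-≤ (sums j) (tangent′ D) ⟩
    (K (m + j) + h d * (j * d)) + (g D + h d * d)
      ≡⟨ rearrange₂ (K (m + j)) (h d) j d (g D) ⟩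
    K (suc (m + j)) + h d * (suc j * d)
      ≡⟨ cong (λ x → K x + h d * (suc j * d)) (+-suc m j) ⟨
    K (m + suc j) + h d * (suc j * d) ∎
    where
    Σj = turánDegreeSum (2 + r) m j
    D = turánDegree (2 + r) (m + j)
    rearrange₃ : ∀ x j y z s e → x + (suc j * y + z * (s + e)) ≡ (x + (j * y + z * s)) + (y + z * e)
    rearrange₃ = solve-∀

-- Lower bounds for sums of Turán degrees

ρi≤r*turánDegree : ∀ ρ i → ρ * i ≤ suc ρ * turánDegree (suc ρ) i
ρi≤r*turánDegree ρ i = begin
  ρ * i                                    ≡⟨ m+n∸m≡n i (ρ * i) ⟨
  suc ρ * i ∸ i                            ≤⟨ ∸-monoʳ-≤ (suc ρ * i) (m/n*n≤m i (suc ρ)) ⟩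
  suc ρ * i ∸ i ℕ./ suc ρ * suc ρ            ≡⟨ cong (suc ρ * i ∸_) (*-comm (i ℕ./ suc ρ) (suc ρ)) ⟩
  suc ρ * i ∸ suc ρ * (i ℕ./ suc ρ)          ≡⟨ *-distribˡ-∸ (suc ρ) i (i ℕ./ suc ρ) ⟨
  suc ρ * turánDegree (suc ρ) i            ∎
  where open ≤-Reasoning

-- Each term `turánDegree (suc ρ) i` is at least ρi/(ρ+1). Summing over the j consecutive values
-- from m and multiplying by 2(ρ+1) gives ρ(2jm + j² - j).
turánDegreeSum-lower : ∀ ρ m j →
  ρ * (2 * j * m + j * j) ≤ 2 * suc ρ * turánDegreeSum (suc ρ) m j + ρ * j
turánDegreeSum-lower ρ m zero = ≤-trans (≤-reflexive (*-zeroʳ ρ)) z≤n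
turánDegreeSum-lower ρ m (suc j) =
  linear-≤ 0 (+-mono-≤ (turánDegreeSum-lower ρ m j) (*-monoʳ-≤ 2 (ρi≤r*turánDegree ρ (m + j))))
    (rearrange ρ m j (turánDegreeSum (suc ρ) m j) (turánDegree (suc ρ) (m + j)))
  where
  rearrange : ∀ ρ m j s d → (2 * suc ρ * (s + d) + ρ * suc j) + (ρ * (2 * j * m + j * j) + 2 * (ρ * (m + j)))
    ≡ ρ * (2 * suc j * m + suc j * suc j) + ((2 * suc ρ * s + ρ * j) + 2 * (suc ρ * d)) + 0
  rearrange = solve-∀

-- `avg` says that x is at most ρ(2m+j-1)/(2(ρ+1)), the average of the lower bounds ρi/(ρ+1) over
-- the j terms.
product≤turánDegreeSum : ∀ ρ m j x → 2 * suc ρ * x + ρ ≤ ρ * (2 * m + j) → j * x ≤ turánDegreeSum (suc ρ) m j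
product≤turánDegreeSum ρ m j x avg = *-cancelˡ-≤ (2 * suc ρ)
  (linear-≤ 0 (+-mono-≤ (*-monoʳ-≤ j avg) (turánDegreeSum-lower ρ m j))
    (rearrange ρ m j x (turánDegreeSum (suc ρ) m j)))
  where
  rearrange : ∀ ρ m j x s → 2 * suc ρ * s + (j * (2 * suc ρ * x + ρ) + ρ * (2 * j * m + j * j))
    ≡ 2 * suc ρ * (j * x) + (j * (ρ * (2 * m + j)) + (2 * suc ρ * s + ρ * j)) + 0
  rearrange = solve-∀

-- All s + 1 vertices are deleted, with d = s + a, r = 4 + z and n = m + s + 1. Then `thr` is the
-- bound on n for r ≥ 8 with denominators cleared, and `small` is 2d + 2 ≤ n + a.
fullDeletion : ∀ z a s m → z * (a + 4) + 4 * (a + 3) ≤ z * (m + suc s) → 2 * suc s + a ≤ m + suc s →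
  suc s * (s + a) ≤ a + turánDegreeSum (4 + z) m s
fullDeletion z a s m thr small = ≤-trans (≤-reflexive (split s a))
  (+-monoʳ-≤ a (product≤turánDegreeSum (3 + z) m s (suc (s + a)) (*-cancelˡ-≤ 2
    -- The weight 3z + 12 = 3r on `small` balances the coefficients of m: 4(r-1) = (r-4) + 3r. What
    -- is left over is 2 + 2s.
    (linear-≤ (2 + 2 * s) (+-mono-≤ thr (*-monoʳ-≤ (3 * z + 12) small)) (certificate z a s m)))))
  where
  split : ∀ s a → suc s * (s + a) ≡ a + s * suc (s + a)
  split = solve-∀
  certificate : ∀ z a s m →
    2 * ((3 + z) * (2 * m + s)) + ((z * (a + 4) + 4 * (a + 3)) + (3 * z + 12) * (2 * suc s + a))
    ≡ 2 * (2 * (4 + z) * suc (s + a) + (3 + z)) + (z * (m + suc s) + (3 * z + 12) * (m + suc s)) + (2 + 2 * s)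
  certificate = solve-∀

-- The last hypothesis is what the averaging bound becomes on eliminating h and s by 2h ≤ s + 1 and 2(s + 1) + a ≤ n.
halfDeletion : ∀ w a s h m → 2 * h ≤ suc s → s ≤ 2 * h → 2 * suc s + a ≤ m + suc h →
  (3 * w + 10) * a + 20 * w + 48 ≤ (3 * w + 2) * (m + suc h) →
  suc h * (s + a) ≤ a + turánDegreeSum (3 + w) m h
halfDeletion w a s h m 2h≤1+s s≤2h small thr = ≤-trans
  -- By s ≤ 2h it is enough that the h Turán degrees average at least d + 2, where d = s + a.
  (linear-≤ 0 s≤2h (split s a h))
  (+-monoʳ-≤ a (product≤turánDegreeSum (2 + w) m h (2 + (s + a)) (*-cancelˡ-≤ 4
    (linear-≤ 0
      (+-mono-≤ (+-mono-≤ (*-monoʳ-≤ (2 * (2 + w)) 2h≤1+s) (*-monoʳ-≤ (5 * w + 14) small)) thr)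
      (certificate w a s h m)))))
  where
  split : ∀ s a h → (a + h * (2 + (s + a))) + s ≡ suc h * (s + a) + 2 * h + 0
  split = solve-∀
  certificate : ∀ w a s h m →
    4 * ((2 + w) * (2 * m + h)) + ((2 * (2 + w) * (2 * h) + (5 * w + 14) * (2 * suc s + a)) + ((3 * w + 10) * a + 20 * w + 48))
    ≡ 4 * (2 * (3 + w) * (2 + (s + a)) + (2 + w))
      + ((2 * (2 + w) * suc s + (5 * w + 14) * (m + suc h)) + (3 * w + 2) * (m + suc h)) + 0
  certificate = solve-∀

-- The lower bound on n for r = 3 + w ≤ 7, with a = ℓ + 1 and denominators cleared.
smallThreshold : (w a n : ℕ) → Bool
smallThreshold zero a n = 6 * a + 20 ≤ᵇ n
smallThreshold w@(suc _) a n =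
  (w * (a + 2) + 4 * (a + 1) ≤ᵇ w * n) ∧ ((2 * w + 4) * (a + 4) + (w + 2 * a + 8) ≤ᵇ (2 * w + 4) * n)

-- The tests are Boolean so that `finiteCheck` is settled by evaluation. The number of deleted
-- vertices is j + 1.
deletes : (w a s n j : ℕ) → Bool
deletes w a s n j = suc j * (s + a) ≤ᵇ a + turánDegreeSum (3 + w) (n ∸ suc j) j

someDeletion : (w a s n : ℕ) → Bool
someDeletion w a s n = deletes w a s n ⌊ suc s /2⌋ ∨ deletes w a s n s

allBelow : ℕ → (ℕ → Bool) → Bool
allBelow zero f = true
allBelow (suc m) f = f m ∧ allBelow m f

allBelow⁻ : ∀ {m f} → T (allBelow m f) → ∀ {i} → i < m → T (f i)
allBelow⁻ {suc m} {f} all {i} (s≤s i≤m) with fm , rest ← to (T-∧ {f m}) all | m≤n⇒m<n∨m≡n i≤m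
... | inj₁ i<m = allBelow⁻ rest i<m
... | inj₂ refl = fm

_implies_ : Bool → Bool → Bool
b implies c = not b ∨ c

implies⁻ : ∀ {b c} → T (b implies c) → T b → T c
implies⁻ {true} bc _ = bc

casesₛ : (w n a s : ℕ) → Bool
casesₛ w n a s = (2 * suc s + a ≤ᵇ n) implies someDeletion w a s n

-- For n < 44, the inequality 2(s+1) + a ≤ n forces s < 22 and a < 44.
casesₐ : (w n a : ℕ) → Bool
casesₐ w n a = smallThreshold w a n implies allBelow 22 (casesₛ w n a)

casesₙ : (w n : ℕ) → Bool
casesₙ w n = allBelow 44 (casesₐ w n)

cases : ℕ → Bool
cases w = allBelow 44 (casesₙ w)

-- The case 3 ≤ r ≤ 7, n < 44, where halfDeletion does not always apply.
finiteCheck : T (allBelow 5 cases)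
finiteCheck = _

firstBound : ∀ z a n → T (smallThreshold (suc z) a n) → suc z * (a + 2) + 4 * (a + 1) ≤ suc z * n
firstBound z a n thr = ≤ᵇ⇒≤ _ _ (proj₁ (to (T-∧ {suc z * (a + 2) + 4 * (a + 1) ≤ᵇ suc z * n}) thr))

-- In each case the threshold has a larger slope in `a` than the hypothesis of `halfDeletion`, so it
-- implies the latter for large n. The constant 44 is set by r = 3, where 6a + 20 and 5a + 24 meet;
-- the multipliers make the coefficients of `a` agree.
largeThreshold : ∀ w {a n} → w < 5 → 44 ≤ n → T (smallThreshold w a n) → (3 * w + 10) * a + 20 * w + 48 ≤ (3 * w + 2) * n
largeThreshold 0 {a} {n} _ 44≤n thr = *-cancelˡ-≤ 3 (linear-≤ 0 (+-mono-≤ (*-monoʳ-≤ 5 (≤ᵇ⇒≤ (6 * a + 20) n thr)) 44≤n) (certificate a n))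
  where
  certificate : ∀ a n → 3 * (2 * n) + (5 * (6 * a + 20) + 44) ≡ 3 * (10 * a + 0 + 48) + (5 * n + n) + 0
  certificate = solve-∀
largeThreshold 1 {a} {n} _ 44≤n thr = *-cancelˡ-≤ 5 (linear-≤ 266 (+-mono-≤ (*-monoʳ-≤ 13 (firstBound 0 a n thr)) (*-monoʳ-≤ 12 44≤n)) (certificate a n))
  where
  certificate : ∀ a n → 5 * (5 * n) + (13 * (1 * (a + 2) + 4 * (a + 1)) + 12 * 44) ≡ 5 * (13 * a + 20 + 48) + (13 * (1 * n) + 12 * n) + 266
  certificate = solve-∀
largeThreshold 2 {a} {n} _ 44≤n thr = *-cancelˡ-≤ 3 (linear-≤ 152 (+-mono-≤ (*-monoʳ-≤ 8 (firstBound 1 a n thr)) (*-monoʳ-≤ 8 44≤n)) (certificate a n))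
  where
  certificate : ∀ a n → 3 * (8 * n) + (8 * (2 * (a + 2) + 4 * (a + 1)) + 8 * 44) ≡ 3 * (16 * a + 40 + 48) + (8 * (2 * n) + 8 * n) + 152
  certificate = solve-∀
largeThreshold 3 {a} {n} _ 44≤n thr = *-cancelˡ-≤ 7 (linear-≤ 314 (+-mono-≤ (*-monoʳ-≤ 19 (firstBound 2 a n thr)) (*-monoʳ-≤ 20 44≤n)) (certificate a n))
  where
  certificate : ∀ a n → 7 * (11 * n) + (19 * (3 * (a + 2) + 4 * (a + 1)) + 20 * 44) ≡ 7 * (19 * a + 60 + 48) + (19 * (3 * n) + 20 * n) + 314
  certificate = solve-∀
largeThreshold 4 {a} {n} _ 44≤n thr = *-cancelˡ-≤ 4 (linear-≤ 148 (+-mono-≤ (*-monoʳ-≤ 11 (firstBound 3 a n thr)) (*-monoʳ-≤ 12 44≤n)) (certificate a n))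
  where
  certificate : ∀ a n → 4 * (14 * n) + (11 * (4 * (a + 2) + 4 * (a + 1)) + 12 * 44) ≡ 4 * (22 * a + 80 + 48) + (11 * (4 * n) + 12 * n) + 148
  certificate = solve-∀
largeThreshold (suc (suc (suc (suc (suc _))))) (s≤s (s≤s (s≤s (s≤s (s≤s ())))))

-- The number of deleted vertices

-- Of the `s` available vertices j + 1 are deleted, leaving a graph on `m′` vertices. `bound` is the
-- comparison for t = 2 that `turánCliques-exchange` asks for.
record Deletion (r a n d s : ℕ) .{{_ : ℕ.NonZero r}} : Set where
  constructor deletion
  field
    j m′  : ℕ
    n≡    : n ≡ m′ + suc j
    j<s   : j < s
    bound : suc j * d ≤ a + turánDegreeSum r m′ j

n≡n∸j+j : ∀ {n j} → j ≤ n → n ≡ n ∸ j + j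
n≡n∸j+j j≤n = sym (m∸n+n≡m j≤n)

smallDeletion : ∀ {w a n s} → w < 5 → T (smallThreshold w a n) → 2 * suc s + a ≤ n →
  Deletion (3 + w) a n (s + a) (suc s)
smallDeletion {w} {a} {n} {s} w<5 thr small with 44 ≤? n
... | yes 44≤n = deletion h (n ∸ suc h) n≡ (s≤s h≤s)
  (halfDeletion w a s h (n ∸ suc h) 2h≤1+s s≤2h (subst (2 * suc s + a ≤_) n≡ small)
    (subst (λ n → _ ≤ (3 * w + 2) * n) n≡ (largeThreshold w w<5 44≤n thr)))
  where
  h = ⌊ suc s /2⌋
  h≤s : h ≤ s
  -- `⌊ suc s /2⌋` is by definition `⌈ s /2⌉`.
  h≤s = ⌈n/2⌉≤n s
  n≡ : n ≡ n ∸ suc h + suc h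
  n≡ = n≡n∸j+j (≤-trans (s≤s h≤s) 1+s≤n)
    where 1+s≤n = m+n≤o⇒m≤o (suc s) (m+n≤o⇒m≤o (2 * suc s) small)
  2*-≡ : ∀ x → 2 * x ≡ x + x
  2*-≡ = solve-∀
  2h≤1+s : 2 * h ≤ suc s
  2h≤1+s = subst (2 * h ≤_) (⌊n/2⌋+⌈n/2⌉≡n (suc s))
    (≤-trans (≤-reflexive (2*-≡ h)) (+-monoʳ-≤ h (⌊n/2⌋≤⌈n/2⌉ (suc s))))
  s≤2h : s ≤ 2 * h
  s≤2h = subst (_≤ 2 * h) (⌊n/2⌋+⌈n/2⌉≡n s)
    (≤-trans (+-monoˡ-≤ h (⌊n/2⌋≤⌈n/2⌉ s)) (≤-reflexive (sym (2*-≡ h))))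
... | no 44≰n = found (to (T-∨ {deletes w a s n ⌊ suc s /2⌋}) some)
  where
  n<44 = ≰⇒> 44≰n
  s<22 : s < 22
  s<22 = *-cancelˡ-< 2 s 22 (≤-<-trans (≤-trans (*-monoʳ-≤ 2 (n≤1+n s)) (m+n≤o⇒m≤o (2 * suc s) small)) n<44)
  some : T (someDeletion w a s n)
  some = implies⁻ (allBelow⁻ {f = casesₛ w n a} (implies⁻ {smallThreshold w a n}
    (allBelow⁻ {f = casesₐ w n} (allBelow⁻ {f = casesₙ w} (allBelow⁻ {f = cases} finiteCheck w<5) n<44) a<44)
    thr) s<22) (≤⇒≤ᵇ small)
    where a<44 = ≤-<-trans (m+n≤o⇒n≤o (2 * suc s) small) n<44
  delete : ∀ {j} → j ≤ s → T (deletes w a s n j) → Deletion (3 + w) a n (s + a) (suc s)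
  delete {j} j≤s del = deletion j (n ∸ suc j) (n≡n∸j+j (≤-trans (s≤s j≤s) (m+n≤o⇒m≤o (suc s) (m+n≤o⇒m≤o (2 * suc s) small))))
    (s≤s j≤s) (≤ᵇ⇒≤ _ _ del)
  found : T (deletes w a s n ⌊ suc s /2⌋) ⊎ T (deletes w a s n s) → Deletion (3 + w) a n (s + a) (suc s)
  found (inj₁ half) = delete (⌈n/2⌉≤n s) half
  found (inj₂ full) = delete ≤-refl full

largeDeletion : ∀ {z a n s} → z * (a + 4) + 4 * (a + 3) ≤ z * n → 2 * suc s + a ≤ n →
  Deletion (4 + z) a n (s + a) (suc s)
largeDeletion {z} {a} {n} {s} thr small = deletion s (n ∸ suc s) n≡ ≤-refl
  (fullDeletion z a s (n ∸ suc s) (subst (λ n → _ ≤ z * n) n≡ thr) (subst (2 * suc s + a ≤_) n≡ small))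
  where n≡ = n≡n∸j+j (m+n≤o⇒m≤o (suc s) (m+n≤o⇒m≤o (2 * suc s) small))

deletionExists : ∀ {r a n d s} .{{_ : ℕ.NonZero r}} →
  (∀ {s} → 2 * suc s + a ≤ n → Deletion r a n (s + a) (suc s)) →
  0 < s → s ≤ n → d < a + s → 2 + (d + d) ≤ n + a → Deletion r a n d s
deletionExists {r} {a} {n} {d} {s} large 0<s s≤n d<a+s 2+2d≤n+a with ≤-total d a
-- For d ≤ ℓ + 1 one vertex is deleted, and the sum is empty.
... | inj₁ d≤a = deletion 0 (n ∸ 1) (n≡n∸j+j (≤-trans 0<s s≤n)) 0<s
  (≤-trans (≤-reflexive (+-identityʳ d)) (≤-trans d≤a (≤-reflexive (sym (+-identityʳ a)))))
-- Otherwise d = a + o, and d < a + s leaves at least o + 1 = d - ℓ vertices, as many as `large` may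
-- delete.
... | inj₂ a≤d with o , refl ← m≤n⇒∃[o]m+o≡n a≤d = record
  { Deletion del
  ; j<s = ≤-trans (Deletion.j<s del) (+-cancelˡ-≤ a (suc o) s (subst (_≤ a + s) (sym (+-suc a o)) d<a+s))
  ; bound = subst (λ d → suc (Deletion.j del) * d ≤ a + turánDegreeSum r (Deletion.m′ del) (Deletion.j del)) (+-comm o a) (Deletion.bound del) }
  where
  certificate : ∀ a o n → n + (2 + ((a + o) + (a + o))) ≡ (2 * suc o + a) + (n + a) + 0
  certificate = solve-∀
  del = large {o} (linear-≤ 0 2+2d≤n+a (certificate a o n))

-- The threshold

open import Data.Integer as ℤ using (ℤ; +_; -1ℤ; 1ℤ)
import Data.Integer.Properties as ℤ
import Data.Integer.Tactic.RingSolver as ℤ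
open import Data.Rational.Unnormalised as ℚᵘ using (_/_)
import Data.Rational.Unnormalised.Properties as ℚᵘ

sum-of-fractions-≤ : ∀ {x y} X Y d n → x ≡ + X → y ≡ + Y →
  x / 1 ℚᵘ.+ y / suc d ℚᵘ.≤ + n / 1 → suc d * X + Y ≤ suc d * n
sum-of-fractions-≤ X Y d n refl refl ≤n = ℤ.drop‿+≤+ (subst₂ ℤ._≤_ lhs rhs (ℚᵘ.drop-*≤* ≤n))
  where
  open ≡-Reasoning
  lhs : (+ X ℤ.* + suc d ℤ.+ + Y ℤ.* + 1) ℤ.* + 1 ≡ + (suc d * X + Y)
  lhs = begin
    (+ X ℤ.* + suc d ℤ.+ + Y ℤ.* + 1) ℤ.* + 1   ≡⟨ ℤ.*-identityʳ _ ⟩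
    + X ℤ.* + suc d ℤ.+ + Y ℤ.* + 1             ≡⟨ cong₂ ℤ._+_ (sym (ℤ.pos-* X (suc d))) (ℤ.*-identityʳ (+ Y)) ⟩
    + (X * suc d + Y)                           ≡⟨ cong (λ z → + (z + Y)) (*-comm X (suc d)) ⟩
    + (suc d * X + Y)                           ∎
  -- The denominator of the sum of fractions is `1 * suc d`, which reduces to `suc (d + 0)`.
  rhs : + n ℤ.* + suc (d + 0) ≡ + (suc d * n)
  rhs = begin
    + n ℤ.* + suc (d + 0)   ≡⟨ cong (λ z → + n ℤ.* + suc z) (+-identityʳ d) ⟩
    + n ℤ.* + suc d         ≡⟨ ℤ.pos-* n (suc d) ⟨
    + (n * suc d)           ≡⟨ cong +_ (*-comm n (suc d)) ⟩
    + (suc d * n)           ∎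

pred+ : ∀ a c → (+ a ℤ.+ -1ℤ) ℤ.+ + suc c ≡ + (a + c)
pred+ a c = ℤ.+-assoc (+ a) -1ℤ (+ suc c)

+pred : ∀ a c → + suc c ℤ.+ (+ a ℤ.+ -1ℤ) ≡ + (a + c)
+pred a c = trans (ℤ.+-comm (+ suc c) (+ a ℤ.+ -1ℤ)) (pred+ a c)

4*pred+ : ∀ a c → + 4 ℤ.* ((+ a ℤ.+ -1ℤ) ℤ.+ + suc c) ≡ + (4 * (a + c))
4*pred+ a c = trans (cong (+ 4 ℤ.*_) (pred+ a c)) (sym (ℤ.pos-* 4 (a + c)))

*pred : ∀ m a → + m ℤ.* (+ a ℤ.+ -1ℤ) ≡ + (m * a) ℤ.+ ℤ.- + m
*pred m a = trans (ℤ.*-distribˡ-+ (+ m) (+ a) -1ℤ)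
  (cong₂ ℤ._+_ (sym (ℤ.pos-* m a)) (trans (ℤ.*-comm (+ m) -1ℤ) (ℤ.-1*i≡-i (+ m))))

6*pred+26 : ∀ a → + 6 ℤ.* (+ a ℤ.+ -1ℤ) ℤ.+ + 26 ≡ + (6 * a + 20)
6*pred+26 a = trans (cong (ℤ._+ + 26) (*pred 6 a)) (ℤ.+-assoc (+ (6 * a)) (ℤ.- + 6) (+ 26))

r+2*pred+7 : ∀ w a → + (3 + w) ℤ.+ + 2 ℤ.* (+ a ℤ.+ -1ℤ) ℤ.+ + 7 ≡ + (w + 2 * a + 8)
r+2*pred+7 w a = trans (cong (λ z → + (3 + w) ℤ.+ z ℤ.+ + 7) (*pred 2 a)) (rearrange (+ w) (+ (2 * a)))
  where
  rearrange : ∀ x y → (+ 3 ℤ.+ x) ℤ.+ (y ℤ.+ ℤ.- + 2) ℤ.+ + 7 ≡ x ℤ.+ y ℤ.+ + 8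
  rearrange = ℤ.solve-∀

-- Here r = 4 + z, and `2 * suc z + 4` is 2r - 2; it agrees with the denominator in `threshold` by
-- evaluation at a literal z.
mediumThreshold : ∀ z a n → let ℓ = + a ℤ.+ -1ℤ in
  ((+ 3 ℤ.+ ℓ) / 1 ℚᵘ.+ (+ 4 ℤ.* (ℓ ℤ.+ + 2)) / suc z)
    ℚᵘ.⊔
  ((+ 5 ℤ.+ ℓ) / 1 ℚᵘ.+ (+ (4 + z) ℤ.+ + 2 ℤ.* ℓ ℤ.+ + 7) / (2 * suc z + 4)) ℚᵘ.≤ + n / 1 →
  T (smallThreshold (suc z) a n)
mediumThreshold z a n thr = from T-∧
  ( ≤⇒≤ᵇ (sum-of-fractions-≤ (a + 2) (4 * (a + 1)) z n (+pred a 2) (4*pred+ a 1)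
      (ℚᵘ.≤-trans (ℚᵘ.p≤p⊔q _ _) thr))
  , ≤⇒≤ᵇ (sum-of-fractions-≤ (a + 4) (suc z + 2 * a + 8) _ n (+pred a 4) (r+2*pred+7 (suc z) a)
      (ℚᵘ.≤-trans (ℚᵘ.p≤q⊔p ((+ 3 ℤ.+ (+ a ℤ.+ -1ℤ)) / 1 ℚᵘ.+ (+ 4 ℤ.* ((+ a ℤ.+ -1ℤ) ℤ.+ + 2)) / suc z) _) thr)) )

-- The values 3 ≤ r ≤ 7 are listed one by one so that `threshold` reduces. In the last clause r = 8
-- + z, so r - 4 is `4 + z`.
thresholdDeletion : ∀ w a n → threshold (3 + w) (+ a ℤ.+ -1ℤ) ℚᵘ.≤ + n / 1 → ∀ {s} → 2 * suc s + a ≤ n →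
  Deletion (3 + w) a n (s + a) (suc s)
thresholdDeletion 0 a n thr = smallDeletion {0} (<ᵇ⇒< 0 5 _) (≤⇒≤ᵇ {6 * a + 20} (ℤ.drop‿+≤+
  (subst₂ ℤ._≤_ (trans (ℤ.*-identityʳ _) (6*pred+26 a)) (ℤ.*-identityʳ (+ n)) (ℚᵘ.drop-*≤* thr))))
thresholdDeletion 1 a n thr = smallDeletion {1} (<ᵇ⇒< 1 5 _) (mediumThreshold 0 a n thr)
thresholdDeletion 2 a n thr = smallDeletion {2} (<ᵇ⇒< 2 5 _) (mediumThreshold 1 a n thr)
thresholdDeletion 3 a n thr = smallDeletion {3} (<ᵇ⇒< 3 5 _) (mediumThreshold 2 a n thr)
thresholdDeletion 4 a n thr = smallDeletion {4} (<ᵇ⇒< 4 5 _) (mediumThreshold 3 a n thr)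
thresholdDeletion (suc (suc (suc (suc (suc z))))) a n thr =
  largeDeletion {4 + z} (sum-of-fractions-≤ (a + 4) (4 * (a + 3)) (3 + z) n (pred+ a 4) (4*pred+ a 3) thr)

-- From a low-degree set to the clique bound

-- `delete-low` removes j + 1 vertices of degree at most `d`, and `turánCliques-exchange` trades
-- them for a single one of degree `a`; here m + j = n - 1.
lowDegreeSet-bound : ∀ {n} (G : Graph n) w t a → KFree (4 + w) G → (low : LowDegreeSet G a) →
  Deletion (3 + w) a n (LowDegreeSet.d low) ∣ LowDegreeSet.S low ∣ →
  k (2 + t) G ≤ turánCliques (3 + w) (2 + t) (n ∸ 1) + turánCliques (2 + w) (1 + t) a
lowDegreeSet-bound {n} G w t a free low (deletion j m n≡ j<s bound) = begin
  k (2 + t) G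
    ≡⟨ k≡cliques-⊤ (2 + t) G ⟩
  cliques G (2 + t) ⊤
    ≤⟨ delete-low G (2 + w) (1 + t) d (suc j) m {L = S} (λ Q (size , _ , clique) → free (Q , size , clique))
         ⊆⊤ deg≤d j<s (trans (∣⊤∣≡n n) n≡) ⟩
  turánCliques (3 + w) (2 + t) m + suc j * turánCliques (2 + w) (1 + t) d
    ≤⟨ turánCliques-exchange (1 + w) t m j a d bound ⟩
  turánCliques (3 + w) (2 + t) (m + j) + turánCliques (2 + w) (1 + t) a
    ≡⟨ cong (λ x → turánCliques (3 + w) (2 + t) x + turánCliques (2 + w) (1 + t) a)
         (sym (cong (_∸ 1) (trans n≡ (+-suc m j)))) ⟩
  turánCliques (3 + w) (2 + t) (n ∸ 1) + turánCliques (2 + w) (1 + t) a ∎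
  where
  open ≤-Reasoning
  open LowDegreeSet low

theorem2p20 : ∀ {p : Level} (ℓ : ℤ) → -1ℤ ℤ.≤ ℓ →
    (P : ∀ {m : ℕ} → Graph m → Set p) →
    (∀ (m : ℕ) → Stable (+ m ℤ.+ ℓ) (P {m})) →
    (nP : ℤ) → (∀ (m : ℕ) → nP ℤ.≤ + m → (K : Graph m) → IsComplete K → P K) →
    (r n : ℕ) → 3 ≤ r → nP ℤ.≤ + n → threshold r ℓ ℚᵘ.≤ (+ n) / 1 →
    (G* : Graph n) → IsGStar ℓ r G* →
    ((G : Graph n) → KFree (suc r) G → ¬ P G → ∀ (t : ℕ) → 2 ≤ t → k t G ≤ k t G*)
    × (¬ P G* →
    Σ[ G ∈ Graph n ] KFree (suc r) G × ¬ P G × (∀ (t : ℕ) → 2 ≤ t → k t G ≡ k t G*))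
theorem2p20 ℓ _ P stable nP complete (suc (suc (suc w))) n (s≤s (s≤s (s≤s z≤n))) nP≤n thr G* gstar =
  -- `G*` is itself K_(r+1)-free, so it attains the bound when it lacks `P`.
  upper , λ ¬PG* → G* , IsGStar⇒KFree G* gstar , ¬PG* , λ _ _ → refl
  where
  open IsGStar gstar using (x; N-size)
  -- The size of the neighbourhood of `x` represents ℓ + 1 as a natural number.
  a : ℕ
  a = ∣ N G* x ∣
  ℓ≡ : ℓ ≡ + a ℤ.+ -1ℤ
  ℓ≡ = sym (trans (cong (ℤ._+ -1ℤ) N-size) (trans (ℤ.+-assoc ℓ 1ℤ -1ℤ) (ℤ.+-identityʳ ℓ)))
  stable′ : ∀ G u v u≢v → ¬ Adj G u v → P (addEdge G u≢v) → n + a ≤ suc (deg G u + deg G v) → P G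
  stable′ G u v u≢v ¬uv PG+uv heavy = stable n G u v u≢v ¬uv PG+uv
    -- Adding -1 to both sides turns `heavy` into n + ℓ ≤ deg u + deg v.
    (subst (ℤ._≤ + (deg G u + deg G v)) (trans (ℤ.+-assoc (+ n) (+ a) -1ℤ) (cong (λ z → + n ℤ.+ z) (sym ℓ≡)))
      (ℤ.+-monoˡ-≤ -1ℤ (ℤ.+≤+ heavy)))
  upper : ∀ G → KFree (4 + w) G → ¬ P G → ∀ t → 2 ≤ t → k t G ≤ k t G*
  upper G free ¬PG (suc (suc t)) (s≤s (s≤s z≤n)) =
    ≤-trans (lowDegreeSet-bound G w t a free low
      (deletionExists (thresholdDeletion w a n (subst (λ ℓ → threshold (3 + w) ℓ ℚᵘ.≤ + n / 1) ℓ≡ thr))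
        nonempty (∣p∣≤n S) large d-small))
      (GStar-cliques G* gstar (1 + t))
    where
    low = lowDegreeSet a P stable′ (complete n nP≤n) G ¬PG
    open LowDegreeSet low
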